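{- Let $p$ be a prime, $k\ge1$, $q=p^k$. Every integer of the form $$D=AB^{q-1},$$ where $A,B\in\mathbb Z$ satisfy $\gcd(A,q-1)=1$ and $B\equiv A\pmod q$, is an integer group determinant of $GA(1,q)$.
   Context: For a finite group $G=\{g_1,\dots,g_n\}$ and an element $\sum_{g\in G}a_g g$ of the group ring $\mathbb Z[G]$ (all $a_g\in\mathbb Z$), the group determinant is $D\left(\sum_{g\in G}a_g g\right)=\det\left(a_{g_ig_j^{ -1}}\right)_{i,j=1}^n$. An integer group determinant of $G$ is any integer of this form. The general affine group of degree one over $\mathbb F_q$ is $GA(1,q)=\left\{\begin{pmatrix} a & b\\ 0 & 1\end{pmatrix}: a\in\mathbb F_q^*,\ b\in\mathbb F_q\right\}$ under matrix multiplication. -}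

module Defs where

open import Level using (Level; 0ℓ; _⊔_)
open import Algebra.Bundles using (CommutativeRing; Group)
open import Algebra.Apartness.Bundles using (HeytingCommutativeRing; HeytingField)
import Algebra.Apartness.Properties.HeytingCommutativeRing as HeytingProperties
import Algebra.Properties.Ring as RingProperties
import Algebra.Properties.Semiring.Sum as SemiringSum
open import Data.Fin.Base using (Fin; zero; suc; toℕ; punchIn; punchOut)
open import Data.Fin.Properties as Fin
  using (any?; *↔×; punchInᵢ≢i; punchIn-punchOut; punchOut-punchIn; punchOut-cong)
open import Data.Integer.Base as ℤ using (ℤ; -1ℤ; 1ℤ)
import Data.Integer.Properties as ℤ
open import Data.Nat.Base as ℕ using (ℕ; zero; suc; pred)
open import Data.Product.Base using (Σ; ∃; _×_; _,_; proj₁; proj₂)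
open import Data.Product.Function.NonDependent.Setoid using (_×-inverse_)
open import Data.Product.Relation.Binary.Pointwise.NonDependent
  using (_×ₛ_; ≡×≡⇒≡; ≡⇒≡×≡)
open import Data.Vec.Functional using (Vector; _∷_; [])
open import Function.Base using (_∘_)
open import Function.Bundles using (Func; Inverse; _⟨$⟩_)
import Function.Construct.Composition as Compose
open import Relation.Binary.Bundles using (Setoid)
import Relation.Binary.Construct.On as On
import Relation.Binary.Reasoning.Setoid as ≈-Reasoning
open import Relation.Binary.PropositionalEquality as ≡ using (_≡_; _≢_; refl)
open import Relation.Nullary using (¬_; Dec; yes; no; contradiction)
open import Relation.Nullary.Decidable using (map′)

private
  variable
    c ℓ ℓ₁ ℓ₂ : Level
    n : ℕ

------------------------------------------------------------------------
-- Matrices and determinants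

Matrix : Set c → ℕ → Set c
Matrix A n = Vector (Vector A n) n

open SemiringSum ℤ.+-*-semiring using () renaming (sum to sumℤ)

minor : Matrix ℤ (suc n) → Fin (suc n) → Matrix ℤ n
minor M j r s = M (suc r) (punchIn j s)

-- Cofactor expansion along the first row.
det : Matrix ℤ n → ℤ
det {zero}  M = 1ℤ
det {suc n} M = sumℤ λ j → -1ℤ ℤ.^ toℕ j ℤ.* M zero j ℤ.* det (minor M j)

------------------------------------------------------------------------
-- Finite groups and their integer group determinants

record FiniteGroup c ℓ : Set (Level.suc (c ⊔ ℓ)) where
  field
    group       : Group c ℓ
    order       : ℕ
    enumeration : Inverse (≡.setoid (Fin order)) (Group.setoid group)

  open Group group public

  element : Fin order → Carrier
  element = Inverse.to enumeration

-- As the group is finite, an element of ℤ[G] is any family (a_g) of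
-- integers; since G is a setoid, the family must respect its equality.
GroupRing : FiniteGroup c ℓ → Set (c ⊔ ℓ)
GroupRing G = Func (FiniteGroup.setoid G) (≡.setoid ℤ)

groupMatrix : (G : FiniteGroup c ℓ) → GroupRing G → Matrix ℤ (FiniteGroup.order G)
groupMatrix G a i j = a ⟨$⟩ (element i ∙ element j ⁻¹)
  where open FiniteGroup G

groupDeterminant : (G : FiniteGroup c ℓ) → GroupRing G → ℤ
groupDeterminant G a = det (groupMatrix G a)

IsIntegerGroupDeterminant : FiniteGroup c ℓ → ℤ → Set (c ⊔ ℓ)
IsIntegerGroupDeterminant G d = ∃ λ (a : GroupRing G) → groupDeterminant G a ≡ d

------------------------------------------------------------------------
-- Finite fields

-- In a Heyting field x # y holds iff x - y is invertible, and # is tight.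
-- In the finite case equality and # are decidable, so x # y is the same
-- as ¬ x ≈ y and this is the usual notion of a finite field.
record FiniteField c ℓ₁ ℓ₂ : Set (Level.suc (c ⊔ ℓ₁ ⊔ ℓ₂)) where
  field
    heytingField : HeytingField c ℓ₁ ℓ₂

  open HeytingField heytingField public

  field
    order       : ℕ
    enumeration : Inverse (≡.setoid (Fin order)) setoid

  commutativeRing : CommutativeRing c ℓ₁
  commutativeRing = HeytingCommutativeRing.commutativeRing heytingCommutativeRing

------------------------------------------------------------------------
-- The general affine group of degree one

module GeneralAffine (F : FiniteField c ℓ₁ ℓ₂) where

  open FiniteField F
  open HeytingProperties heytingCommutativeRing
    using (x-0≈x; 1#0; x#0y#0→xy#0; #-congʳ; invertibleʳ⇒#)
  open RingProperties (CommutativeRing.ring commutativeRing) using (-‿distribʳ-*)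
  open SemiringSum (CommutativeRing.semiring commutativeRing) using (sum)
  private
    module E = Inverse enumeration

  UnitSetoid : Setoid (c ⊔ ℓ₂) ℓ₁
  UnitSetoid = On.setoid {B = Σ Carrier (_# 0#)} setoid proj₁

  Unit : Set (c ⊔ ℓ₂)
  Unit = Setoid.Carrier UnitSetoid

  inv : Unit → Carrier
  inv (a , a#0) = proj₁ (#⇒invertible a#0)

  inv-inverseˡ : ∀ u → inv u * proj₁ u ≈ 1#
  inv-inverseˡ (a , a#0) =
    trans (*-congˡ (sym (x-0≈x a))) (proj₁ (proj₂ (#⇒invertible a#0)))

  inv-inverseʳ : ∀ u → proj₁ u * inv u ≈ 1#
  inv-inverseʳ u = trans (*-comm _ _) (inv-inverseˡ u)

  inv-unit : Unit → Unit
  inv-unit u@(a , a#0) = inv u , invertibleʳ⇒# (a , trans (*-congʳ (x-0≈x _)) (inv-inverseˡ u))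

  inv-cong : ∀ u v → proj₁ u ≈ proj₁ v → inv u ≈ inv v
  inv-cong u v u≈v = begin
    inv u                      ≈⟨ *-identityʳ _ ⟨
    inv u * 1#                 ≈⟨ *-congˡ (inv-inverseʳ v) ⟨
    inv u * (proj₁ v * inv v)  ≈⟨ *-assoc _ _ _ ⟨
    inv u * proj₁ v * inv v    ≈⟨ *-congʳ (*-congˡ u≈v) ⟨
    inv u * proj₁ u * inv v    ≈⟨ *-congʳ (inv-inverseˡ u) ⟩
    1# * inv v                 ≈⟨ *-identityˡ _ ⟩
    inv v                      ∎
    where open ≈-Reasoning setoid

  -- ((a , _) , b) stands for the matrix with rows (a , b) and (0 , 1).
  Affine : Set (c ⊔ ℓ₂)
  Affine = Unit × Carrier

  infixl 7 _·_

  _·_ : Affine → Affine → Affine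
  ((a , a#0) , b) · ((a′ , a′#0) , b′) =
    (a * a′ , x#0y#0→xy#0 a#0 a′#0) , a * b′ + b

  affineGroup : Group (c ⊔ ℓ₂) ℓ₁
  affineGroup = record
    { Carrier = Affine
    ; _≈_     = Setoid._≈_ (UnitSetoid ×ₛ setoid)
    ; _∙_     = _·_
    ; ε       = (1# , 1#0) , 0#
    ; _⁻¹     = λ (u , b) → inv-unit u , - (inv u * b)
    ; isGroup = record
      { isMonoid = record
        { isSemigroup = record
          { isMagma = record
            { isEquivalence = Setoid.isEquivalence (UnitSetoid ×ₛ setoid)
            ; ∙-cong        = λ (p , q) (p′ , q′) →
                *-cong p p′ , +-cong (*-cong p q′) q
            }
          ; assoc = λ ((a , _) , b) ((a′ , _) , b′) ((a″ , _) , b″) →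
              *-assoc a a′ a″ , assoc-lemma a b a′ b′ b″
          }
        ; identity =
            (λ ((a , _) , b) → *-identityˡ a , trans (+-identityʳ _) (*-identityˡ b))
          , (λ ((a , _) , b) → *-identityʳ a , trans (+-congʳ (zeroʳ a)) (+-identityˡ b))
        }
      ; inverse =
          (λ (u , b) → inv-inverseˡ u , -‿inverseʳ _)
        , (λ (u , b) → inv-inverseʳ u , inverseʳ-lemma u b)
      ; ⁻¹-cong = λ {(u , _)} {(v , _)} (p , q) →
          inv-cong u v p , -‿cong (*-cong (inv-cong u v p) q)
      }
    }
    where
    open ≈-Reasoning setoid

    assoc-lemma : ∀ a b a′ b′ b″ →
                  a * a′ * b″ + (a * b′ + b) ≈ a * (a′ * b″ + b′) + b
    assoc-lemma a b a′ b′ b″ = begin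
      a * a′ * b″ + (a * b′ + b)    ≈⟨ +-assoc _ _ _ ⟨
      a * a′ * b″ + a * b′ + b      ≈⟨ +-congʳ (+-congʳ (*-assoc a a′ b″)) ⟩
      a * (a′ * b″) + a * b′ + b    ≈⟨ +-congʳ (distribˡ a _ _) ⟨
      a * (a′ * b″ + b′) + b        ∎

    inverseʳ-lemma : ∀ u b → proj₁ u * - (inv u * b) + b ≈ 0#
    inverseʳ-lemma u b = begin
      proj₁ u * - (inv u * b) + b    ≈⟨ +-congʳ (-‿distribʳ-* _ _) ⟨
      - (proj₁ u * (inv u * b)) + b  ≈⟨ +-congʳ (-‿cong (*-assoc _ _ _)) ⟨
      - (proj₁ u * inv u * b) + b    ≈⟨ +-congʳ (-‿cong (*-congʳ (inv-inverseʳ u))) ⟩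
      - (1# * b) + b                 ≈⟨ +-congʳ (-‿cong (*-identityˡ b)) ⟩
      - b + b                        ≈⟨ -‿inverseˡ b ⟩
      0#                             ∎

  -- The product above is matrix multiplication.

  toMatrix : Affine → Matrix Carrier 2
  toMatrix ((a , _) , b) = (a ∷ b ∷ []) ∷ (0# ∷ 1# ∷ []) ∷ []

  toMatrix-homo : ∀ x y i j →
    toMatrix (x · y) i j ≈ sum (λ k → toMatrix x i k * toMatrix y k j)
  toMatrix-homo ((a , _) , b) ((a′ , _) , b′) zero zero = sym (begin
    a * a′ + (b * 0# + 0#)   ≈⟨ +-congˡ (trans (+-identityʳ _) (zeroʳ b)) ⟩
    a * a′ + 0#              ≈⟨ +-identityʳ _ ⟩
    a * a′                   ∎)
    where open ≈-Reasoning setoid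
  toMatrix-homo ((a , _) , b) ((a′ , _) , b′) zero (suc zero) =
    +-congˡ (sym (trans (+-identityʳ _) (*-identityʳ b)))
  toMatrix-homo ((a , _) , b) ((a′ , _) , b′) (suc zero) zero = sym (begin
    0# * a′ + (1# * 0# + 0#) ≈⟨ +-cong (zeroˡ a′) (trans (+-identityʳ _) (zeroʳ 1#)) ⟩
    0# + 0#                  ≈⟨ +-identityʳ _ ⟩
    0#                       ∎)
    where open ≈-Reasoning setoid
  toMatrix-homo ((a , _) , b) ((a′ , _) , b′) (suc zero) (suc zero) = sym (begin
    0# * b′ + (1# * 1# + 0#) ≈⟨ +-cong (zeroˡ b′) (trans (+-identityʳ _) (*-identityʳ 1#)) ⟩
    0# + 1#                  ≈⟨ +-identityˡ _ ⟩
    1#                       ∎)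
    where open ≈-Reasoning setoid

  -- Enumeration of the units: skip the index of 0.

  _≈?_ : ∀ x y → Dec (x ≈ y)
  x ≈? y = map′
    (λ eq → trans (sym (E.strictlyInverseˡ x)) (trans (E.to-cong eq) (E.strictlyInverseˡ y)))
    E.from-cong
    (E.from x Fin.≟ E.from y)

  ≉0⇒#0 : ∀ x → ¬ x ≈ 0# → x # 0#
  ≉0⇒#0 x x≉0 with any? (λ i → ((x - 0#) * E.to i) ≈? 1#)
  ... | yes (i , eq) = invertibleʳ⇒# (E.to i , eq)
  ... | no  none     = contradiction (proj₁ (tight x 0#) ¬x#0) x≉0
    where
    ¬x#0 : ¬ x # 0#
    ¬x#0 x#0 with #⇒invertible x#0
    ... | y , _ , xy≈1 =
      none (E.from y , trans (*-congˡ (E.strictlyInverseˡ y)) xy≈1)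

  #0⇒≉0 : ∀ x → x # 0# → ¬ x ≈ 0#
  #0⇒≉0 x x#0 x≈0 = #-irrefl x≈0 x#0

  private
    Others : Fin n → Setoid 0ℓ 0ℓ
    Others i = On.setoid {B = Σ (Fin _) (i ≢_)} (≡.setoid (Fin _)) proj₁

    others : (i : Fin n) → Inverse (≡.setoid (Fin (pred n))) (Others i)
    others {suc n} i = record
      { to        = λ j → punchIn i j , punchInᵢ≢i i j ∘ ≡.sym
      ; from      = λ (k , i≢k) → punchOut i≢k
      ; to-cong   = ≡.cong (punchIn i)
      ; from-cong = punchOut-cong i
      ; inverse   = (λ { {k , i≢k} refl → punchIn-punchOut i≢k })
                  , (λ {j} eq → ≡.trans (punchOut-cong i eq) (punchOut-punchIn i))
      }

    othersUnit : Inverse (Others (E.from 0#)) UnitSetoid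
    othersUnit = record
      { to        = λ (k , 0≢k) → E.to k , ≉0⇒#0 (E.to k) λ k≈0 →
                      0≢k (≡.trans (≡.sym (E.from-cong k≈0)) (E.strictlyInverseʳ k))
      ; from      = λ (x , x#0) → E.from x , λ eq → #0⇒≉0 x x#0
                      (trans (sym (E.strictlyInverseˡ x))
                        (trans (E.to-cong (≡.sym eq)) (E.strictlyInverseˡ 0#)))
      ; to-cong   = E.to-cong
      ; from-cong = E.from-cong
      ; inverse   = E.inverseˡ , E.inverseʳ
      }

    pairs : ∀ {m n} → Inverse (≡.setoid (Fin (m ℕ.* n)))
                              (≡.setoid (Fin m) ×ₛ ≡.setoid (Fin n))
    pairs {m} {n} = Compose.inverse (*↔× {m} {n}) record
      { to        = λ p → p
      ; from      = λ p → p
      ; to-cong   = ≡⇒≡×≡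
      ; from-cong = ≡×≡⇒≡
      ; inverse   = ≡⇒≡×≡ , ≡×≡⇒≡
      }

  unitEnumeration : Inverse (≡.setoid (Fin (pred order))) UnitSetoid
  unitEnumeration = Compose.inverse (others (E.from 0#)) othersUnit

  finiteGroup : FiniteGroup (c ⊔ ℓ₂) ℓ₁
  finiteGroup = record
    { group       = affineGroup
    ; order       = pred order ℕ.* order
    ; enumeration = Compose.inverse pairs (unitEnumeration ×-inverse enumeration)
    }

GA₁ : FiniteField c ℓ₁ ℓ₂ → FiniteGroup (c ⊔ ℓ₂) ℓ₁
GA₁ = GeneralAffine.finiteGroup

module Submission where

open import Defs using (FiniteField; GA₁; IsIntegerGroupDeterminant)

-- Let n = q - 1, let x generate the cyclic group 𝔽q*, and write A = a + t n
-- with 0 ≤ a < n and B = A + q m. The determinant is attained by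
--   α = 1 + x + ⋯ + xᵃ⁻¹ + N (t + m - m τ),
-- where 𝔽q* is identified with the matrices (h , 0), N is the sum of all of
-- them and τ = (1 , 1). In the coordinates g = (h , h u) the group matrix has
-- the entries
--   (s (h′ / h) + t + m) [u′ = u] - m [u′ - u = 1 / h],
-- where s h is the coefficient of h in 1 + ⋯ + xᵃ⁻¹. Multiply it on the left
-- by Z, which sums all block rows and, for every h′ other than 1, subtracts
-- block row h′ / x from block row h′: below the first block row this leaves
-- ([h′ = h] - [h′ = xᵃ h]) [u′ = u]. As a is coprime to n, the powers of xᵃ
-- enumerate 𝔽q* as well, and in this enumeration the product is again block
-- triangular in the way Z is, but with first block row adding up to
-- n (B I - m J) instead of n I, where J is the all-ones matrix. Comparing
-- both determinants gives n ^ q · D = n ^ q · A B ^ (q - 1).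

-- In the coordinates (h , h u) the contribution of `N (t + m - m τ)` is the same in all block rows,
-- so the differences in Z annihilate it and only the summed first block row sees it. There s adds
-- up to a and N contributes a factor n, which restores A = a + t n. Summing that row over h
-- replaces [u′ - u = 1 / h] by J - I, because 1 / h runs through all nonzero elements. The
-- coefficient of I becomes n (A + n m + m), which is n B since n + 1 = q. On constant vectors B I -
-- m J acts as B - q m = A, and modulo them as B. This is how the congruence modulo q and the
-- exponent q - 1 arise. Two enumerations are unavoidable: s telescopes along powers of x, while
-- [h′ = xᵃ h] links neighbours among powers of xᵃ. Passing from one to the other permutes rows and
-- columns alike and so preserves the determinant. The price of the summed row is that Z has
-- determinant n ^ q instead of 1; this factor is cancelled in ℤ at the very end.

module Determinants where

  open import Defs using (Matrix; minor; det)
  import Algebra.Properties.CommutativeMonoid.Sum as MonoidSum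
  import Algebra.Properties.Semiring.Sum as SemiringSum
  open import Data.Fin.Base as Fin using (Fin; zero; suc; toℕ; inject₁; punchIn; punchOut)
  import Data.Fin.Properties as Fin
  open import Data.Integer.Base as ℤ using (ℤ; 0ℤ; 1ℤ; -1ℤ; _+_; _*_; _^_)
  import Data.Integer.Properties as ℤ
  open import Data.Integer.Tactic.RingSolver using (solve-∀)
  open import Data.Nat.Base as ℕ using (ℕ; zero; suc; z≤n; s≤s)
  import Data.Nat.Properties as ℕ
  open import Data.Vec.Functional as Vector using (Vector; _∷_; head; tail; insertAt)
  import Data.Vec.Functional.Properties as Vector
  open import Function.Base using (_∘_)
  open import Function.Bundles using (Inverse)
  open import Relation.Binary.Bundles using (Setoid)
  open import Relation.Binary.PropositionalEquality
  open import Relation.Nullary using (yes; no; contradiction)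

  module ∑ = SemiringSum ℤ.+-*-semiring
  module ∏ = MonoidSum ℤ.*-1-commutativeMonoid
  open ∑ using (sum)
  open ∏ using () renaming (sum to product)
  open ≡-Reasoning

  -- Alternating multilinear functions of the rows of a matrix.

  Rows : ℕ → ℕ → Set
  Rows k m = Vector (Vector ℤ m) k

  infix 4 _≐_

  _≐_ : ∀ {k m} → Rows k m → Rows k m → Set
  M ≐ N = ∀ i j → M i j ≡ N i j

  sum-zero : ∀ {n} {f : Vector ℤ n} → (∀ i → f i ≡ 0ℤ) → sum f ≡ 0ℤ
  sum-zero {n} f≡0 = trans (∑.sum-cong-≗ f≡0) (∑.sum-replicate-zero n)

  δ : ∀ {n} → Fin n → Fin n → ℤ
  δ zero    zero    = 1ℤ
  δ zero    (suc j) = 0ℤ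
  δ (suc i) zero    = 0ℤ
  δ (suc i) (suc j) = δ i j

  δ-refl : ∀ {n} (i : Fin n) → δ i i ≡ 1ℤ
  δ-refl zero    = refl
  δ-refl (suc i) = δ-refl i

  δ-≡ : ∀ {n} {i j : Fin n} → i ≡ j → δ i j ≡ 1ℤ
  δ-≡ {i = i} refl = δ-refl i

  δ-≢ : ∀ {n} {i j : Fin n} → i ≢ j → δ i j ≡ 0ℤ
  δ-≢ {i = zero}  {zero}  i≢j = contradiction refl i≢j
  δ-≢ {i = zero}  {suc j} i≢j = refl
  δ-≢ {i = suc i} {zero}  i≢j = refl
  δ-≢ {i = suc i} {suc j} i≢j = δ-≢ (i≢j ∘ cong suc)

  δ-sym : ∀ {n} (i j : Fin n) → δ i j ≡ δ j i
  δ-sym zero    zero    = refl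
  δ-sym zero    (suc j) = refl
  δ-sym (suc i) zero    = refl
  δ-sym (suc i) (suc j) = δ-sym i j

  ∑-δˡ : ∀ {n} (i : Fin n) (f : Vector ℤ n) → sum (λ k → δ i k * f k) ≡ f i
  ∑-δˡ zero f = begin
    1ℤ * f zero + sum (λ k → 0ℤ * f (suc k)) ≡⟨ cong ((1ℤ * f zero) +_) (sum-zero (λ k → ℤ.*-zeroˡ (f (suc k)))) ⟩
    1ℤ * f zero + 0ℤ                         ≡⟨ arith (f zero) ⟩
    f zero                                   ∎
    where
    arith : ∀ x → 1ℤ * x + 0ℤ ≡ x
    arith = solve-∀
  ∑-δˡ (suc i) f = begin
    0ℤ * f zero + sum (λ k → δ i k * f (suc k)) ≡⟨ cong₂ _+_ (ℤ.*-zeroˡ (f zero)) (∑-δˡ i (f ∘ suc)) ⟩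
    0ℤ + f (suc i)                              ≡⟨ ℤ.+-identityˡ _ ⟩
    f (suc i)                                   ∎

  ∑-δʳ : ∀ {n} (j : Fin n) (f : Vector ℤ n) → sum (λ k → f k * δ k j) ≡ f j
  ∑-δʳ j f = trans (∑.sum-cong-≗ (λ k → trans (ℤ.*-comm (f k) _) (cong (_* f k) (δ-sym k j)))) (∑-δˡ j f)

  -- The combination with `c` bundles additivity and homogeneity. Rows are functions compared
  -- pointwise, so `cong-≐` stands in for function extensionality and `linear` describes the three
  -- matrices by their entries.
  record Multilinear {k m} (f : Rows k m → ℤ) : Set where
    field
      cong-≐ : ∀ {M N} → M ≐ N → f M ≡ f N
      linear : ∀ c i {M N P} → (∀ j → M i j ≡ c * N i j + P i j) →
               (∀ r → r ≢ i → ∀ j → M r j ≡ N r j) →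
               (∀ r → r ≢ i → ∀ j → M r j ≡ P r j) →
               f M ≡ c * f N + f P

  -- Only neighbouring equal rows are demanded, which is what induction over cofactors delivers;
  -- `repeated-head` recovers a repetition of the first row at any distance.
  record Alternating {k m} (f : Rows k m → ℤ) : Set where
    field
      multilinear : Multilinear f
      adjacent    : ∀ {i i′} M → toℕ i′ ≡ suc (toℕ i) → (∀ j → M i j ≡ M i′ j) → f M ≡ 0ℤ
    open Multilinear multilinear public

  ∷-≐ : ∀ {k m} {u v : Vector ℤ m} {S T : Rows k m} →
        (∀ j → u j ≡ v j) → S ≐ T → (u ∷ S) ≐ (v ∷ T)
  ∷-≐ u≗v S≐T zero    j = u≗v j
  ∷-≐ u≗v S≐T (suc i) j = S≐T i j

  ∷-η : ∀ {k m} (M : Rows (suc k) m) → M ≐ (head M ∷ tail M)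
  ∷-η M zero    j = refl
  ∷-η M (suc i) j = refl

  module _ {k m} {f : Rows (suc k) m → ℤ} where

    multilinear-tail : Multilinear f → ∀ v → Multilinear (λ T → f (v ∷ T))
    multilinear-tail F v = record
      { cong-≐ = λ S≐T → cong-≐ (∷-≐ (λ _ → refl) S≐T)
      ; linear = λ c i eq eqN eqP → linear c (suc i) eq
          (λ { zero _ j → refl ; (suc r) r≢i → eqN r (r≢i ∘ cong suc) })
          (λ { zero _ j → refl ; (suc r) r≢i → eqP r (r≢i ∘ cong suc) })
      }
      where open Multilinear F

    alternating-tail : Alternating f → ∀ v → Alternating (λ T → f (v ∷ T))
    alternating-tail F v = record
      { multilinear = multilinear-tail multilinear v
      ; adjacent    = λ T eq → adjacent (v ∷ T) (cong suc eq)
      }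
      where open Alternating F

    linear-head : Multilinear f → ∀ c u v {w} T → (∀ j → w j ≡ c * u j + v j) →
                  f (w ∷ T) ≡ c * f (u ∷ T) + f (v ∷ T)
    linear-head F c u v T eq = Multilinear.linear F c zero eq
      (λ { zero 0≢0 → contradiction refl 0≢0 ; (suc r) _ j → refl })
      (λ { zero 0≢0 → contradiction refl 0≢0 ; (suc r) _ j → refl })

    head-zero : Multilinear f → ∀ {v} T → (∀ j → v j ≡ 0ℤ) → f (v ∷ T) ≡ 0ℤ
    head-zero F {v} T v≡0 = trans
      (linear-head F -1ℤ v v T λ j → trans (v≡0 j) (cong (λ x → -1ℤ * x + x) (sym (v≡0 j))))
      (cancel (f (v ∷ T)))
      where
      cancel : ∀ x → -1ℤ * x + x ≡ 0ℤ
      cancel = solve-∀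

    head-sum : Multilinear f → ∀ {n} (c : Vector ℤ n) (V : Rows n m) T →
               f ((λ s → sum (λ j → c j * V j s)) ∷ T) ≡ sum (λ j → c j * f (V j ∷ T))
    head-sum F {zero}  c V T = head-zero F T λ _ → refl
    head-sum F {suc n} c V T = trans
      (linear-head F (c zero) (V zero) _ T λ _ → refl)
      (cong ((c zero * f (V zero ∷ T)) +_) (head-sum F (c ∘ suc) (V ∘ suc) T))

  -- Serves two purposes: with `ι` inserting a zero entry it turns `f` into a function of minors,
  -- and with `ι` multiplying a row by a fixed matrix it yields the multiplicativity of `det`.
  rowwise : ∀ {k m m′} {f : Rows k m′ → ℤ} (ι : Vector ℤ m → Vector ℤ m′) →
            (∀ {u v} → (∀ j → u j ≡ v j) → ∀ j → ι u j ≡ ι v j) →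
            (∀ c {u v w} → (∀ j → w j ≡ c * u j + v j) → ∀ j → ι w j ≡ c * ι u j + ι v j) →
            Alternating f → Alternating (λ M → f (ι ∘ M))
  rowwise ι ι-cong ι-linear F = record
    { multilinear = record
      { cong-≐ = λ M≐N → cong-≐ (λ i → ι-cong (M≐N i))
      ; linear = λ c i eq eqN eqP → linear c i (ι-linear c eq)
          (λ r r≢i → ι-cong (eqN r r≢i)) (λ r r≢i → ι-cong (eqP r r≢i))
      }
    ; adjacent = λ M eq eq′ → adjacent _ eq (ι-cong eq′)
    }
    where open Alternating F

  module _ {k m} {f : Rows (suc (suc k)) m → ℤ} (F : Alternating f) where
    open Alternating F

    -- Polarisation: expand `f` with both heads equal to `w`, the sum of `u` and `v`. The value and
    -- its two diagonal terms vanish, so the mixed terms add up to zero.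
    swap-heads : ∀ u v T → f (u ∷ v ∷ T) ≡ -1ℤ * f (v ∷ u ∷ T)
    swap-heads u v T = begin
      f (u ∷ v ∷ T)                                 ≡⟨ arith (f (u ∷ v ∷ T)) (f (v ∷ u ∷ T)) ⟩
      (1ℤ * (1ℤ * 0ℤ + f (u ∷ v ∷ T)) + (1ℤ * f (v ∷ u ∷ T) + 0ℤ)) + -1ℤ * f (v ∷ u ∷ T)
        ≡⟨ cong (_+ (-1ℤ * f (v ∷ u ∷ T))) sum≡0 ⟩
      0ℤ + -1ℤ * f (v ∷ u ∷ T)                      ≡⟨ ℤ.+-identityˡ _ ⟩
      -1ℤ * f (v ∷ u ∷ T)                           ∎
      where
      w : Vector ℤ m
      w j = 1ℤ * u j + v j
      arith : ∀ x y → x ≡ (1ℤ * (1ℤ * 0ℤ + x) + (1ℤ * y + 0ℤ)) + -1ℤ * y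
      arith = solve-∀
      same : ∀ x → f (x ∷ x ∷ T) ≡ 0ℤ
      same x = adjacent {zero} {suc zero} (x ∷ x ∷ T) refl λ _ → refl
      second : ∀ x → f (x ∷ w ∷ T) ≡ 1ℤ * f (x ∷ u ∷ T) + f (x ∷ v ∷ T)
      second x = linear-head (multilinear-tail multilinear x) 1ℤ u v T λ _ → refl
      sum≡0 : 1ℤ * (1ℤ * 0ℤ + f (u ∷ v ∷ T)) + (1ℤ * f (v ∷ u ∷ T) + 0ℤ) ≡ 0ℤ
      sum≡0 = begin
        1ℤ * (1ℤ * 0ℤ + f (u ∷ v ∷ T)) + (1ℤ * f (v ∷ u ∷ T) + 0ℤ)
          ≡⟨ cong₂ (λ x y → 1ℤ * (1ℤ * x + f (u ∷ v ∷ T)) + (1ℤ * f (v ∷ u ∷ T) + y)) (same u) (same v) ⟨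
        1ℤ * (1ℤ * f (u ∷ u ∷ T) + f (u ∷ v ∷ T)) + (1ℤ * f (v ∷ u ∷ T) + f (v ∷ v ∷ T))
          ≡⟨ cong₂ (λ x y → 1ℤ * x + y) (second u) (second v) ⟨
        1ℤ * f (u ∷ w ∷ T) + f (v ∷ w ∷ T) ≡⟨ linear-head multilinear 1ℤ u v (w ∷ T) (λ _ → refl) ⟨
        f (w ∷ w ∷ T)                      ≡⟨ same w ⟩
        0ℤ                                 ∎

    swap-heads′ : ∀ M → f M ≡ -1ℤ * f (M (suc zero) ∷ M zero ∷ (λ i → M (suc (suc i))))
    swap-heads′ M = trans
      (cong-≐ λ { zero j → refl ; (suc zero) j → refl ; (suc (suc i)) j → refl })
      (swap-heads (M zero) (M (suc zero)) (λ i → M (suc (suc i))))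

  -- Swapping the first two rows puts the repeated row at the head of the tail, one step closer to
  -- its copy.
  repeated-head : ∀ {k m} {f : Rows (suc k) m → ℤ} → Alternating f →
                  ∀ M i → (∀ j → M zero j ≡ M (suc i) j) → f M ≡ 0ℤ
  repeated-head F M zero    eq = Alternating.adjacent F {zero} {suc zero} M refl eq
  repeated-head F M (suc i) eq = trans (swap-heads′ F M)
    (cong (-1ℤ *_) (repeated-head (alternating-tail F (M (suc zero))) _ i eq))

  -- Row `i` passes `toℕ i` others on its way to the top, at the cost of one sign each. These are
  -- the signs of the cofactor expansion.
  rotate : ∀ {k m} {f : Rows (suc k) m → ℤ} → Alternating f →
           ∀ M i → f (M i ∷ (M ∘ punchIn i)) ≡ -1ℤ ^ toℕ i * f M
  rotate {f = f} F M zero = trans (Alternating.cong-≐ F λ i j → sym (∷-η M i j)) (sym (ℤ.*-identityˡ _))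
  rotate {suc k} {f = f} F M (suc i) = begin
    f (M (suc i) ∷ (M ∘ punchIn (suc i)))
      ≡⟨ swap-heads′ F _ ⟩
    -1ℤ * f (M zero ∷ M (suc i) ∷ (λ r → M (suc (punchIn i r))))
      ≡⟨ cong (-1ℤ *_) (rotate (alternating-tail F (M zero)) (tail M) i) ⟩
    -1ℤ * (-1ℤ ^ toℕ i * f (M zero ∷ tail M))
      ≡⟨ ℤ.*-assoc -1ℤ (-1ℤ ^ toℕ i) (f (M zero ∷ tail M)) ⟨
    -1ℤ ^ toℕ (suc i) * f (M zero ∷ tail M)
      ≡⟨ cong ((-1ℤ ^ toℕ (suc i)) *_) (Alternating.cong-≐ F (∷-η M)) ⟨
    -1ℤ ^ toℕ (suc i) * f M ∎

  -- By linearity a row sheds its multiple of `e` at the cost of a value of `f` with `e` itself as a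
  -- row, which vanishes. With `e` = `δ j` standing above the rows, this clears column `j` below it.
  subtract-multiples : ∀ {k m} {f : Rows k m → ℤ} → Multilinear f → ∀ (e : Vector ℤ m) →
    (∀ T i → (∀ j → T i j ≡ e j) → f T ≡ 0ℤ) →
    ∀ (c : Vector ℤ k) {T T′} → (∀ i j → T i j ≡ c i * e j + T′ i j) → f T ≡ f T′
  subtract-multiples {zero}  F e vanish c eq = Multilinear.cong-≐ F λ ()
  subtract-multiples {suc k} {f = f} F e vanish c {T} {T′} eq = begin
    f T                                      ≡⟨ cong-≐ (∷-η T) ⟩
    f (head T ∷ tail T)                      ≡⟨ linear-head F (c zero) e (head T′) (tail T) (eq zero) ⟩
    c zero * f (e ∷ tail T) + f (head T′ ∷ tail T)
      ≡⟨ cong (λ x → c zero * x + f (head T′ ∷ tail T)) (vanish _ zero λ _ → refl) ⟩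
    c zero * 0ℤ + f (head T′ ∷ tail T)       ≡⟨ arith (c zero) _ ⟩
    f (head T′ ∷ tail T)                     ≡⟨ subtract-multiples (multilinear-tail F (head T′)) e
                                                  (λ S i → vanish _ (suc i)) (c ∘ suc) (eq ∘ suc) ⟩
    f (head T′ ∷ tail T′)                    ≡⟨ cong-≐ (∷-η T′) ⟨
    f T′                                     ∎
    where
    open Multilinear F
    arith : ∀ x y → x * 0ℤ + y ≡ y
    arith = solve-∀

  punchIn-elim : ∀ {n} (P : Fin (suc n) → Set) i → P i → (∀ j → P (punchIn i j)) → ∀ j → P j
  punchIn-elim P i pᵢ p j with i Fin.≟ j
  ... | yes refl = pᵢ
  ... | no  i≢j  = subst P (Fin.punchIn-punchOut i≢j) (p (punchOut i≢j))

  δ-punchIn : ∀ {n} (i : Fin (suc n)) j k → δ (punchIn i j) (punchIn i k) ≡ δ j k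
  δ-punchIn zero    j       k       = refl
  δ-punchIn (suc i) zero    zero    = refl
  δ-punchIn (suc i) zero    (suc k) = refl
  δ-punchIn (suc i) (suc j) zero    = refl
  δ-punchIn (suc i) (suc j) (suc k) = δ-punchIn i j k

  -- Expanding the first row in the standard basis reproduces the cofactor
  -- expansion: after clearing column j, f is an alternating function of minor M j.
  alternating-unique : ∀ {n} {f : Rows n n → ℤ} → Alternating f → ∀ M → f M ≡ det M * f δ
  alternating-unique {zero}  {f} F M = trans (Alternating.cong-≐ F λ ()) (sym (ℤ.*-identityˡ _))
  alternating-unique {suc n} {f} F M = begin
    f M
      ≡⟨ cong-≐ (λ { zero s → sym (∑-δʳ s (M zero)) ; (suc r) s → refl }) ⟩
    f ((λ s → sum (λ j → M zero j * δ j s)) ∷ tail M)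
      ≡⟨ head-sum multilinear (M zero) δ (tail M) ⟩
    sum (λ j → M zero j * f (δ j ∷ tail M))
      ≡⟨ ∑.sum-cong-≗ (λ j → trans (cong (M zero j *_) (column j))
           (arith (M zero j) (det (minor M j)) (-1ℤ ^ toℕ j) (f δ))) ⟩
    sum (λ j → -1ℤ ^ toℕ j * M zero j * det (minor M j) * f δ)
      ≡⟨ ∑.*-distribʳ-sum (f δ) (λ j → -1ℤ ^ toℕ j * M zero j * det (minor M j)) ⟨
    det M * f δ ∎
    where
    open Alternating F
    arith : ∀ a d s x → a * (d * (s * x)) ≡ s * a * d * x
    arith = solve-∀
    column : ∀ j → f (δ j ∷ tail M) ≡ det (minor M j) * (-1ℤ ^ toℕ j * f δ)
    column j = begin
      f (δ j ∷ tail M)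
        ≡⟨ subtract-multiples (multilinear-tail multilinear (δ j)) (δ j)
             (λ T i eq → repeated-head F (δ j ∷ T) i (sym ∘ eq))
             (λ r → M (suc r) j) clear ⟩
      f (δ j ∷ (ι ∘ minor M j))
        ≡⟨ alternating-unique (rowwise ι ι-cong ι-linear (alternating-tail F (δ j))) (minor M j) ⟩
      det (minor M j) * f (δ j ∷ (ι ∘ δ))
        ≡⟨ cong (det (minor M j) *_) (cong-≐ (∷-≐ (λ _ → refl) ι-δ)) ⟩
      det (minor M j) * f (δ j ∷ (δ ∘ punchIn j))
        ≡⟨ cong (det (minor M j) *_) (rotate F δ j) ⟩
      det (minor M j) * (-1ℤ ^ toℕ j * f δ) ∎
      where
      ι : Vector ℤ n → Vector ℤ (suc n)
      ι u = insertAt u j 0ℤ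
      at-j : ∀ u → ι u j ≡ 0ℤ
      at-j u = Vector.insertAt-lookup u j 0ℤ
      at-punchIn : ∀ u s → ι u (punchIn j s) ≡ u s
      at-punchIn u = Vector.insertAt-punchIn u j 0ℤ
      clear : ∀ r s → M (suc r) s ≡ M (suc r) j * δ j s + ι (minor M j r) s
      clear r = punchIn-elim _ j
        (sym (trans (cong₂ (λ x y → M (suc r) j * x + y) (δ-refl j) (at-j _)) (arith₁ _)))
        (λ s → sym (trans (cong₂ (λ x y → M (suc r) j * x + y)
          (δ-≢ (Fin.punchInᵢ≢i j s ∘ sym)) (at-punchIn _ s)) (arith₂ (M (suc r) j) _)))
        where
        arith₁ : ∀ x → x * 1ℤ + 0ℤ ≡ x
        arith₁ = solve-∀
        arith₂ : ∀ x y → x * 0ℤ + y ≡ y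
        arith₂ = solve-∀
      ι-cong : ∀ {u v} → (∀ s → u s ≡ v s) → ∀ s → ι u s ≡ ι v s
      ι-cong {u} {v} eq = punchIn-elim _ j (trans (at-j u) (sym (at-j v)))
        (λ s → trans (at-punchIn u s) (trans (eq s) (sym (at-punchIn v s))))
      ι-linear : ∀ c {u v w} → (∀ s → w s ≡ c * u s + v s) → ∀ s → ι w s ≡ c * ι u s + ι v s
      ι-linear c {u} {v} {w} eq = punchIn-elim _ j
        (trans (at-j w) (sym (trans (cong₂ (λ x y → c * x + y) (at-j u) (at-j v)) (arith₀ c))))
        (λ s → trans (at-punchIn w s) (trans (eq s)
          (sym (cong₂ (λ x y → c * x + y) (at-punchIn u s) (at-punchIn v s)))))
        where
        arith₀ : ∀ c → c * 0ℤ + 0ℤ ≡ 0ℤ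
        arith₀ = solve-∀
      ι-δ : (ι ∘ δ) ≐ (δ ∘ punchIn j)
      ι-δ r = punchIn-elim _ j
        (trans (at-j (δ r)) (sym (δ-≢ (Fin.punchInᵢ≢i j r))))
        (λ s → trans (at-punchIn (δ r) s) (sym (δ-punchIn j r s)))

  -- The cofactor determinant is alternating and multilinear.

  det-cong : ∀ {n} {M N : Matrix ℤ n} → M ≐ N → det M ≡ det N
  det-cong {zero}  M≐N = refl
  det-cong {suc n} M≐N = ∑.sum-cong-≗ λ j → cong₂ (λ x y → -1ℤ ^ toℕ j * x * y)
    (M≐N zero j) (det-cong λ r s → M≐N (suc r) (punchIn j s))

  -- Row `i` is either the row of expansion, whose coefficients split while the minors agree, or it
  -- lies in every minor, and the minors split by induction.
  det-linear : ∀ {n} c i {M N P : Matrix ℤ n} → (∀ j → M i j ≡ c * N i j + P i j) →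
               (∀ r → r ≢ i → ∀ j → M r j ≡ N r j) →
               (∀ r → r ≢ i → ∀ j → M r j ≡ P r j) →
               det M ≡ c * det N + det P
  det-linear {suc n} c i {M} {N} {P} eq eqN eqP = begin
    det M                                       ≡⟨ ∑.sum-cong-≗ (term i eq eqN eqP) ⟩
    sum (λ j → c * tN j + tP j)                 ≡⟨ ∑.∑-distrib-+ (λ j → c * tN j) tP ⟩
    sum (λ j → c * tN j) + det P                ≡⟨ cong (_+ det P) (∑.*-distribˡ-sum c tN) ⟨
    c * det N + det P                           ∎
    where
    tN tP : Fin (suc n) → ℤ
    tN j = -1ℤ ^ toℕ j * N zero j * det (minor N j)
    tP j = -1ℤ ^ toℕ j * P zero j * det (minor P j)
    arith₀ : ∀ s c x y d → s * (c * x + y) * d ≡ c * (s * x * d) + s * y * d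
    arith₀ = solve-∀
    arith₁ : ∀ s c x d e → s * x * (c * d + e) ≡ c * (s * x * d) + s * x * e
    arith₁ = solve-∀
    term : ∀ i → (∀ j → M i j ≡ c * N i j + P i j) →
           (∀ r → r ≢ i → ∀ j → M r j ≡ N r j) →
           (∀ r → r ≢ i → ∀ j → M r j ≡ P r j) →
           ∀ j → -1ℤ ^ toℕ j * M zero j * det (minor M j) ≡ c * tN j + tP j
    term zero eq eqN eqP j = begin
      s * M zero j * det (minor M j)
        ≡⟨ cong (λ x → s * x * det (minor M j)) (eq j) ⟩
      s * (c * N zero j + P zero j) * det (minor M j)
        ≡⟨ arith₀ s c (N zero j) (P zero j) _ ⟩
      c * (s * N zero j * det (minor M j)) + s * P zero j * det (minor M j)
        ≡⟨ cong₂ (λ x y → c * (s * N zero j * x) + s * P zero j * y)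
             (det-cong λ r k → eqN (suc r) (λ ()) (punchIn j k))
             (det-cong λ r k → eqP (suc r) (λ ()) (punchIn j k)) ⟩
      c * tN j + tP j ∎
      where s = -1ℤ ^ toℕ j
    term (suc i) eq eqN eqP j = begin
      s * M zero j * det (minor M j)
        ≡⟨ cong ((s * M zero j) *_) (det-linear c i (eq ∘ punchIn j)
             (λ r r≢i → eqN (suc r) (r≢i ∘ Fin.suc-injective) ∘ punchIn j)
             (λ r r≢i → eqP (suc r) (r≢i ∘ Fin.suc-injective) ∘ punchIn j)) ⟩
      s * M zero j * (c * det (minor N j) + det (minor P j))
        ≡⟨ arith₁ s c (M zero j) _ _ ⟩
      c * (s * M zero j * det (minor N j)) + s * M zero j * det (minor P j)
        ≡⟨ cong₂ (λ x y → c * (s * x * det (minor N j)) + s * y * det (minor P j))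
             (eqN zero (λ ()) j) (eqP zero (λ ()) j) ⟩
      c * tN j + tP j ∎
      where s = -1ℤ ^ toℕ j

  -- The terms (j , k) and (k + 1 , j) with j ≤ k remove the same two columns.
  sum-pairs-cancel : ∀ {m} (g : Fin (suc m) → Fin m → ℤ) →
    (∀ j k → j Fin.≤ k → g (inject₁ j) k + g (suc k) j ≡ 0ℤ) →
    sum (λ j → sum (g j)) ≡ 0ℤ
  sum-pairs-cancel {zero}  g cancel = refl
  sum-pairs-cancel {suc m} g cancel = begin
    sum (g zero) + sum (λ j → g (suc j) zero + sum (λ k → g (suc j) (suc k)))
      ≡⟨ cong (sum (g zero) +_) (∑.∑-distrib-+ (λ j → g (suc j) zero) (λ j → sum λ k → g (suc j) (suc k))) ⟩
    sum (g zero) + (sum (λ j → g (suc j) zero) + sum (λ j → sum (λ k → g (suc j) (suc k))))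
      ≡⟨ cong (λ x → sum (g zero) + (sum (λ j → g (suc j) zero) + x))
           (sum-pairs-cancel (λ j k → g (suc j) (suc k)) (λ j k j≤k → cancel (suc j) (suc k) (s≤s j≤k))) ⟩
    sum (g zero) + (sum (λ j → g (suc j) zero) + 0ℤ)
      ≡⟨ cong (sum (g zero) +_) (ℤ.+-identityʳ _) ⟩
    sum (g zero) + sum (λ j → g (suc j) zero)
      ≡⟨ ∑.∑-distrib-+ (g zero) (λ j → g (suc j) zero) ⟨
    sum (λ k → g zero k + g (suc k) zero)
      ≡⟨ sum-zero (λ k → cancel zero k z≤n) ⟩
    0ℤ ∎

  punchIn-inject₁ : ∀ {n} {j k : Fin n} → j Fin.≤ k → punchIn (inject₁ j) k ≡ suc k
  punchIn-inject₁ {j = zero}  {k}     j≤k       = refl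
  punchIn-inject₁ {j = suc j} {suc k} (s≤s j≤k) = cong suc (punchIn-inject₁ j≤k)

  punchIn-suc : ∀ {n} {j k : Fin n} → j Fin.≤ k → punchIn (suc k) j ≡ inject₁ j
  punchIn-suc {j = zero}  {k}     j≤k       = refl
  punchIn-suc {j = suc j} {suc k} (s≤s j≤k) = cong suc (punchIn-suc j≤k)

  punchIn-comm : ∀ {n} {j k : Fin (suc n)} → j Fin.≤ k → ∀ s →
                 punchIn (inject₁ j) (punchIn k s) ≡ punchIn (suc k) (punchIn j s)
  punchIn-comm {j = zero}  {k}     j≤k       s       = refl
  punchIn-comm {j = suc j} {suc k} (s≤s j≤k) zero    = refl
  punchIn-comm {j = suc j} {suc k} (s≤s j≤k) (suc s) = cong suc (punchIn-comm j≤k s)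

  -- For the first two rows, a double expansion has two terms for each pair of columns, one per
  -- order of removal, and these carry opposite signs. Further down, both rows survive in every
  -- minor.
  det-adjacent : ∀ {n} {i i′ : Fin n} (M : Matrix ℤ n) → toℕ i′ ≡ suc (toℕ i) →
                 (∀ j → M i j ≡ M i′ j) → det M ≡ 0ℤ
  det-adjacent {suc (suc n)} {zero} {suc zero} M refl eq = begin
    det M                        ≡⟨ ∑.sum-cong-≗ (λ j → ∑.*-distribˡ-sum (-1ℤ ^ toℕ j * M zero j)
                                      (λ k → -1ℤ ^ toℕ k * M (suc zero) (punchIn j k) * det (minor (minor M j) k))) ⟩
    sum (λ j → sum (λ k → g j k)) ≡⟨ sum-pairs-cancel g cancel ⟩
    0ℤ                           ∎
    where
    g : Fin (suc (suc n)) → Fin (suc n) → ℤ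
    g j k = -1ℤ ^ toℕ j * M zero j * (-1ℤ ^ toℕ k * M (suc zero) (punchIn j k) * det (minor (minor M j) k))
    arith : ∀ s t x y d → s * x * (t * y * d) + -1ℤ * t * y * (s * x * d) ≡ 0ℤ
    arith = solve-∀
    cancel : ∀ j k → j Fin.≤ k → g (inject₁ j) k + g (suc k) j ≡ 0ℤ
    cancel j k j≤k = begin
      g (inject₁ j) k + g (suc k) j
        ≡⟨ cong₂ _+_
             (cong₂ (λ a b → -1ℤ ^ a * M zero (inject₁ j) * (-1ℤ ^ toℕ k * M (suc zero) b * D))
               (Fin.toℕ-inject₁ j) (punchIn-inject₁ j≤k))
             (cong₂ (λ a d → -1ℤ ^ suc (toℕ k) * M zero (suc k) * (-1ℤ ^ toℕ j * M (suc zero) a * d))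
               (punchIn-suc j≤k)
               (det-cong λ r s → cong (M (suc (suc r))) (sym (punchIn-comm j≤k s)))) ⟩
      -1ℤ ^ toℕ j * x * (-1ℤ ^ toℕ k * M (suc zero) (suc k) * D)
        + -1ℤ * -1ℤ ^ toℕ k * M zero (suc k) * (-1ℤ ^ toℕ j * M (suc zero) (inject₁ j) * D)
        ≡⟨ cong₂ (λ a b → -1ℤ ^ toℕ j * x * (-1ℤ ^ toℕ k * a * D)
             + -1ℤ * -1ℤ ^ toℕ k * M zero (suc k) * (-1ℤ ^ toℕ j * b * D))
             (eq (suc k)) (eq (inject₁ j)) ⟨
      -1ℤ ^ toℕ j * x * (-1ℤ ^ toℕ k * y * D) + -1ℤ * -1ℤ ^ toℕ k * y * (-1ℤ ^ toℕ j * x * D)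
        ≡⟨ arith (-1ℤ ^ toℕ j) (-1ℤ ^ toℕ k) x y D ⟩
      0ℤ ∎
      where
      x = M zero (inject₁ j)
      y = M zero (suc k)
      D = det (minor (minor M (inject₁ j)) k)
  det-adjacent {suc n} {suc i} {suc i′} M i′≡1+i eq = sum-zero λ j → trans
    (cong ((-1ℤ ^ toℕ j * M zero j) *_)
      (det-adjacent (minor M j) (ℕ.suc-injective i′≡1+i) (eq ∘ punchIn j)))
    (ℤ.*-zeroʳ (-1ℤ ^ toℕ j * M zero j))

  det-alternating : ∀ {n} → Alternating (det {n})
  det-alternating = record
    { multilinear = record { cong-≐ = det-cong ; linear = det-linear }
    ; adjacent    = det-adjacent
    }

  -- Products, triangular matrices and change of enumeration.

  infixl 7 _⊙_

  _⊙_ : ∀ {n} → Matrix ℤ n → Matrix ℤ n → Matrix ℤ n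
  (M ⊙ N) i j = sum λ k → M i k * N k j

  -- For fixed `N` the left side is alternating in the rows of `M`, hence a multiple of `det M` by
  -- uniqueness; the factor is its value at the identity matrix.
  det-⊙ : ∀ {n} (M N : Matrix ℤ n) → det (M ⊙ N) ≡ det M * det N
  det-⊙ {n} M N = trans
    (alternating-unique (rowwise (λ u j → sum λ k → u k * N k j)
      (λ eq j → ∑.sum-cong-≗ λ k → cong (_* N k j) (eq k)) linear det-alternating) M)
    (cong (det M *_) (det-cong λ i j → ∑-δˡ i (λ k → N k j)))
    where
    arith : ∀ c x y z → (c * x + y) * z ≡ c * (x * z) + y * z
    arith = solve-∀
    linear : ∀ c {u v w} → (∀ k → w k ≡ c * u k + v k) → ∀ j →
             sum (λ k → w k * N k j) ≡ c * sum (λ k → u k * N k j) + sum (λ k → v k * N k j)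
    linear c {u} {v} {w} eq j = begin
      sum (λ k → w k * N k j)
        ≡⟨ ∑.sum-cong-≗ (λ k → trans (cong (_* N k j) (eq k)) (arith c (u k) (v k) (N k j))) ⟩
      sum (λ k → c * (u k * N k j) + v k * N k j)
        ≡⟨ ∑.∑-distrib-+ (λ k → c * (u k * N k j)) _ ⟩
      sum (λ k → c * (u k * N k j)) + sum (λ k → v k * N k j)
        ≡⟨ cong (_+ sum (λ k → v k * N k j)) (∑.*-distribˡ-sum c (λ k → u k * N k j)) ⟨
      c * sum (λ k → u k * N k j) + sum (λ k → v k * N k j) ∎

  det-zero-column : ∀ {n} (M : Matrix ℤ (suc n)) → (∀ i → M i zero ≡ 0ℤ) → det M ≡ 0ℤ
  -- Removing another column keeps the first one. The index `j` forces `n` to be positive, so that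
  -- the minor does have a first column.
  det-minor-zero-column : ∀ {n} (M : Matrix ℤ (suc n)) → (∀ i → M (suc i) zero ≡ 0ℤ) →
                          ∀ j → det (minor M (suc j)) ≡ 0ℤ

  det-zero-column M eq = sum-zero {f = λ j → -1ℤ ^ toℕ j * M zero j * det (minor M j)} λ where
    zero    → trans (cong (λ x → 1ℤ * x * det (minor M zero)) (eq zero)) (ℤ.*-zeroˡ (det (minor M zero)))
    (suc j) → trans
      (cong ((-1ℤ ^ toℕ (suc j) * M zero (suc j)) *_) (det-minor-zero-column M (eq ∘ suc) j))
      (ℤ.*-zeroʳ (-1ℤ ^ toℕ (suc j) * M zero (suc j)))

  det-minor-zero-column {suc n} M eq j = det-zero-column (minor M (suc j)) eq

  det-upperTriangular : ∀ {n} (M : Matrix ℤ n) → (∀ i j → j Fin.< i → M i j ≡ 0ℤ) →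
                        det M ≡ product (λ i → M i i)
  det-upperTriangular {zero}  M upper = refl
  det-upperTriangular {suc n} M upper = begin
    1ℤ * M zero zero * det (minor M zero)
      + sum (λ j → -1ℤ ^ toℕ (suc j) * M zero (suc j) * det (minor M (suc j)))
      ≡⟨ cong₂ _+_
           (cong₂ _*_ (ℤ.*-identityˡ (M zero zero)) (det-upperTriangular (minor M zero) λ i j j<i → upper (suc i) (suc j) (s≤s j<i)))
           (sum-zero λ j → trans
             (cong ((-1ℤ ^ toℕ (suc j) * M zero (suc j)) *_)
               (det-minor-zero-column M (λ i → upper (suc i) zero (s≤s z≤n)) j))
             (ℤ.*-zeroʳ (-1ℤ ^ toℕ (suc j) * M zero (suc j)))) ⟩
    product (λ i → M i i) + 0ℤ
      ≡⟨ ℤ.+-identityʳ _ ⟩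
    product (λ i → M i i) ∎

  det-δ : ∀ {n} → det (δ {n}) ≡ 1ℤ
  det-δ {n} = trans (det-upperTriangular (δ {n}) λ i j j<i → δ-≢ λ i≡j → ℕ.<-irrefl (cong toℕ (sym i≡j)) j<i)
    (trans (∏.sum-cong-≗ {n} δ-refl) (∏.sum-replicate-zero n))

  -- The permutation matrix P satisfies P M₁ = M₂ P and has an inverse, so its
  -- sign never has to be computed.
  module _ {c ℓ} {S : Setoid c ℓ} {n} (e₁ e₂ : Inverse (setoid (Fin n)) S) where
    open Setoid S using (Carrier; _≈_)
    private
      module E₁ = Inverse e₁
      module E₂ = Inverse e₂

    det-reindex : (f : Carrier → Carrier → ℤ) →
                  (∀ {x x′ y y′} → x ≈ x′ → y ≈ y′ → f x y ≡ f x′ y′) →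
                  det (λ i j → f (E₁.to i) (E₁.to j)) ≡ det (λ i j → f (E₂.to i) (E₂.to j))
    det-reindex f f-cong = begin
      det M₁                     ≡⟨ ℤ.*-identityʳ _ ⟨
      det M₁ * 1ℤ                ≡⟨ cong (det M₁ *_) PQ≡1 ⟨
      det M₁ * (det P * det Q)   ≡⟨ arith (det M₁) (det P) (det Q) ⟩
      det P * det M₁ * det Q     ≡⟨ cong (_* det Q) PM₁≡M₂P ⟩
      det M₂ * det P * det Q     ≡⟨ ℤ.*-assoc (det M₂) _ _ ⟩
      det M₂ * (det P * det Q)   ≡⟨ cong (det M₂ *_) PQ≡1 ⟩
      det M₂ * 1ℤ                ≡⟨ ℤ.*-identityʳ _ ⟩
      det M₂                     ∎
      where
      module S = Setoid S
      arith : ∀ x y z → x * (y * z) ≡ y * x * z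
      arith = solve-∀
      M₁ M₂ P Q : Matrix ℤ n
      M₁ i j = f (E₁.to i) (E₁.to j)
      M₂ i j = f (E₂.to i) (E₂.to j)
      π π⁻¹ : Fin n → Fin n
      π i = E₁.from (E₂.to i)
      π⁻¹ i = E₂.from (E₁.to i)
      P i j = δ (π i) j
      Q i j = δ (π⁻¹ i) j
      E₁π : ∀ i → E₁.to (π i) ≈ E₂.to i
      E₁π i = E₁.strictlyInverseˡ (E₂.to i)
      ππ⁻¹ : ∀ i → π (π⁻¹ i) ≡ i
      ππ⁻¹ i = trans (E₁.from-cong (E₂.strictlyInverseˡ (E₁.to i))) (E₁.strictlyInverseʳ i)
      π⁻¹π : ∀ i → π⁻¹ (π i) ≡ i
      π⁻¹π i = trans (E₂.from-cong (E₁.strictlyInverseˡ (E₂.to i))) (E₂.strictlyInverseʳ i)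
      PQ≡1 : det P * det Q ≡ 1ℤ
      PQ≡1 = begin
        det P * det Q ≡⟨ det-⊙ P Q ⟨
        det (P ⊙ Q)   ≡⟨ det-cong (λ i j → trans (∑-δˡ (π i) (λ k → Q k j)) (cong (λ k → δ k j) (π⁻¹π i))) ⟩
        det (δ {n})   ≡⟨ det-δ {n} ⟩
        1ℤ            ∎
      P-δ : ∀ k j → δ (π k) j ≡ δ k (π⁻¹ j)
      P-δ k j with π k Fin.≟ j
      ... | yes refl = trans (δ-refl (π k)) (sym (δ-≡ (sym (π⁻¹π k))))
      ... | no  πk≢j = trans (δ-≢ πk≢j) (sym (δ-≢ {i = k} {π⁻¹ j} λ { refl → πk≢j (ππ⁻¹ j) }))
      PM₁≡M₂P : det P * det M₁ ≡ det M₂ * det P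
      PM₁≡M₂P = begin
        det P * det M₁ ≡⟨ det-⊙ P M₁ ⟨
        det (P ⊙ M₁)   ≡⟨ det-cong (λ i j → trans (∑-δˡ (π i) (λ k → M₁ k j)) (sym (entry i j))) ⟩
        det (M₂ ⊙ P)   ≡⟨ det-⊙ M₂ P ⟩
        det M₂ * det P ∎
        where
        entry : ∀ i j → (M₂ ⊙ P) i j ≡ M₁ (π i) j
        entry i j = begin
          (M₂ ⊙ P) i j                     ≡⟨ ∑.sum-cong-≗ (λ k → cong (M₂ i k *_) (P-δ k j)) ⟩
          sum (λ k → M₂ i k * δ k (π⁻¹ j)) ≡⟨ ∑-δʳ (π⁻¹ j) (M₂ i) ⟩
          M₂ i (π⁻¹ j)                     ≡⟨ f-cong (S.sym (E₁π i)) (E₂.strictlyInverseˡ (E₁.to j)) ⟩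
          M₁ (π i) j                       ∎

-- Block matrices and the comparison of determinants through `Z`.

module BlockDeterminants where

  open import Defs using (Matrix; det)
  open Determinants
  import Algebra.Properties.CommutativeMonoid.Sum as MonoidSum
  open import Algebra.Bundles using (CommutativeMonoid)
  open import Data.Fin.Base as Fin using (Fin; zero; suc; toℕ; inject₁; combine; remQuot; _↑ˡ_; _↑ʳ_)
  import Data.Fin.Properties as Fin
  open import Data.Integer.Base as ℤ using (ℤ; 0ℤ; 1ℤ; -1ℤ; _+_; _*_; _-_; _^_)
  import Data.Integer.Properties as ℤ
  open import Data.Integer.Tactic.RingSolver using (solve-∀)
  open import Data.Nat.Base as ℕ using (ℕ; zero; suc)
  import Data.Nat.Properties as ℕ
  open import Data.Product.Base using (_,_; proj₁; proj₂; uncurry)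
  open import Data.Vec.Functional using (Vector)
  open import Function.Base using (_∘_)
  open import Relation.Binary.PropositionalEquality
  open import Relation.Binary.Definitions using (tri<; tri≈; tri>)
  open import Relation.Nullary using (contradiction)
  open ∑ using (sum)
  open ∏ using () renaming (sum to product)
  open ≡-Reasoning

  module _ {c ℓ} (M : CommutativeMonoid c ℓ) where
    private
      module M = CommutativeMonoid M
      open MonoidSum M using () renaming (sum to sumᴹ)

    sum-++ : ∀ k {l} (f : Vector M.Carrier (k ℕ.+ l)) →
             sumᴹ f M.≈ sumᴹ (λ i → f (i ↑ˡ l)) M.∙ sumᴹ (λ j → f (k ↑ʳ j))
    sum-++ zero    f = M.sym (M.identityˡ _)
    sum-++ (suc k) f = M.trans (M.∙-congˡ (sum-++ k (f ∘ suc))) (M.sym (M.assoc _ _ _))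

    sum-combine : ∀ k l (f : Vector M.Carrier (k ℕ.* l)) →
                  sumᴹ f M.≈ sumᴹ (λ i → sumᴹ (λ j → f (combine {k} i j)))
    sum-combine zero    l f = M.refl
    sum-combine (suc k) l f = M.trans (sum-++ l f) (M.∙-congˡ (sum-combine k l _))

  Array : ℕ → ℕ → Set
  Array n q = Fin n → Fin q → Fin n → Fin q → ℤ

  flatten : ∀ {n q} → Array n q → Matrix ℤ (n ℕ.* q)
  flatten {n} {q} A r s = uncurry (uncurry A (remQuot {n} q r)) (remQuot q s)

  det₂ : ∀ {n q} → Array n q → ℤ
  det₂ A = det (flatten A)

  flatten-combine : ∀ {n q} (A : Array n q) i u j v → flatten A (combine {n} {q} i u) (combine {n} {q} j v) ≡ A i u j v
  flatten-combine A i u j v =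
    cong₂ (λ x y → uncurry (uncurry A x) y) (Fin.remQuot-combine i u) (Fin.remQuot-combine j v)

  infixl 7 _⊙₂_

  _⊙₂_ : ∀ {n q} → Array n q → Array n q → Array n q
  (A ⊙₂ B) i u j v = sum λ k → sum λ w → A i u k w * B k w j v

  det₂-⊙₂ : ∀ {n q} (A B : Array n q) → det₂ (A ⊙₂ B) ≡ det₂ A * det₂ B
  det₂-⊙₂ {n} {q} A B = trans (det-cong entry) (det-⊙ (flatten A) (flatten B))
    where
    entry : flatten (A ⊙₂ B) ≐ (flatten A ⊙ flatten B)
    entry r s = sym (trans
      (sum-combine ℤ.+-0-commutativeMonoid n q (λ t → flatten A r t * flatten B t s))
      (∑.sum-cong-≗ λ k → ∑.sum-cong-≗ λ w →
        cong (λ x → uncurry (uncurry A (remQuot q r)) x * uncurry (uncurry B x) (remQuot q s))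
          (Fin.remQuot-combine k w)))

  det₂-cong : ∀ {n q} {A B : Array n q} → (∀ i u j v → A i u j v ≡ B i u j v) → det₂ A ≡ det₂ B
  det₂-cong {n} {q} {A} {B} eq = det-cong {M = flatten A} {flatten B} λ r s →
    eq (proj₁ (remQuot {n} q r)) (proj₂ (remQuot {n} q r)) (proj₁ (remQuot {n} q s)) (proj₂ (remQuot {n} q s))

  -- `combine` orders pairs lexicographically, so triangularity among blocks together with
  -- triangular diagonal blocks is triangularity after flattening.
  det₂-upperTriangular : ∀ {n q} (A : Array n q) →
    (∀ i u j v → j Fin.< i → A i u j v ≡ 0ℤ) → (∀ i u v → v Fin.< u → A i u i v ≡ 0ℤ) →
    det₂ A ≡ product (λ i → product (λ u → A i u i u))
  det₂-upperTriangular {n} {q} A below inside = begin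
    det₂ A                                                 ≡⟨ det-upperTriangular (flatten A) upper ⟩
    product (λ r → flatten A r r)                          ≡⟨ sum-combine ℤ.*-1-commutativeMonoid n q (λ r → flatten A r r) ⟩
    product (λ i → product (λ u → flatten A (combine {n} {q} i u) (combine {n} {q} i u)))
      ≡⟨ ∏.sum-cong-≗ {n} (λ i → ∏.sum-cong-≗ {q} (λ u → flatten-combine A i u i u)) ⟩
    product (λ i → product (λ u → A i u i u))              ∎
    where
    lexicographic : ∀ (i j : Fin n) (u v : Fin q) → combine {n} {q} j v Fin.< combine {n} {q} i u → A i u j v ≡ 0ℤ
    lexicographic i j u v lt with Fin.<-cmp j i
    ... | tri< j<i _ _ = below i u j v j<i
    ... | tri> _ _ i<j = contradiction (Fin.combine-monoˡ-< u v i<j) (ℕ.<-asym lt)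
    ... | tri≈ _ refl _ = inside i u v (ℕ.+-cancelˡ-< (q ℕ.* toℕ i) (toℕ v) (toℕ u)
      (subst₂ ℕ._<_ (Fin.toℕ-combine i v) (Fin.toℕ-combine i u) lt))
    upper : ∀ r s → s Fin.< r → flatten A r s ≡ 0ℤ
    upper r s s<r = lexicographic _ _ _ _
      (subst₂ Fin._<_ (sym (Fin.combine-remQuot {n} q s)) (sym (Fin.combine-remQuot {n} q r)) s<r)

  ∑∑-cong : ∀ {m n} {f g : Fin m → Fin n → ℤ} → (∀ i j → f i j ≡ g i j) →
            sum (λ i → sum (f i)) ≡ sum (λ i → sum (g i))
  ∑∑-cong eq = ∑.sum-cong-≗ λ i → ∑.sum-cong-≗ (eq i)

  ∑-difference : ∀ {n} (f g : Vector ℤ n) → sum (λ i → f i - g i) ≡ sum f - sum g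
  ∑-difference {n} f g = begin
    sum (λ i → f i - g i)              ≡⟨ ∑.sum-cong-≗ (λ i → arith₁ (f i) (g i)) ⟩
    sum (λ i → f i + -1ℤ * g i)        ≡⟨ ∑.∑-distrib-+ f (λ i → -1ℤ * g i) ⟩
    sum f + sum (λ i → -1ℤ * g i)      ≡⟨ cong (sum f +_) (∑.*-distribˡ-sum -1ℤ g) ⟨
    sum f + -1ℤ * sum g                ≡⟨ arith₁ (sum f) (sum g) ⟨
    sum f - sum g                      ∎
    where
    arith₁ : ∀ x y → x - y ≡ x + -1ℤ * y
    arith₁ = solve-∀

  ∑-δ-difference : ∀ {n} (i j : Fin n) (f : Vector ℤ n) →
                   sum (λ k → (δ i k - δ j k) * f k) ≡ f i - f j
  ∑-δ-difference i j f = begin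
    sum (λ k → (δ i k - δ j k) * f k)         ≡⟨ ∑.sum-cong-≗ (λ k → arith (δ i k) (δ j k) (f k)) ⟩
    sum (λ k → δ i k * f k - δ j k * f k)     ≡⟨ ∑-difference (λ k → δ i k * f k) (λ k → δ j k * f k) ⟩
    sum (λ k → δ i k * f k) - sum (λ k → δ j k * f k) ≡⟨ cong₂ _-_ (∑-δˡ i f) (∑-δˡ j f) ⟩
    f i - f j ∎
    where
    arith : ∀ x y z → (x - y) * z ≡ x * z - y * z
    arith = solve-∀

  ∑-const : ∀ n x → sum {n} (λ _ → x) ≡ ℤ.+ n * x
  ∑-const zero    x = sym (ℤ.*-zeroˡ x)
  ∑-const (suc n) x = trans (cong (x +_) (∑-const n x)) (sym (ℤ.suc-* (ℤ.+ n) x))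

  ∏-const : ∀ n x → product {n} (λ _ → x) ≡ x ^ n
  ∏-const zero    x = refl
  ∏-const (suc n) x = cong (x *_) (∏-const n x)

  differences : ∀ {n} → Fin (suc n) → Fin (suc n) → ℤ
  differences zero    k = 1ℤ
  differences (suc i) k = δ (suc i) k - δ (inject₁ i) k

  -- The indicator of i ≤ k, that is, the summation matrix: multiplied on the right of `differences`
  -- it leaves unit vectors in all rows but the first (`tails-step`).
  tails : ∀ {n} → Fin n → Fin n → ℤ
  tails k       zero    = 1ℤ
  tails zero    (suc i) = 0ℤ
  tails (suc k) (suc i) = tails k i

  tails-step : ∀ {n} (k : Fin n) i → tails (suc k) i - tails (inject₁ k) i ≡ δ (suc k) i
  tails-step k       zero          = refl
  tails-step zero    (suc zero)    = refl
  tails-step zero    (suc (suc i)) = refl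
  tails-step (suc k) (suc i)       = tails-step k i

  -- A change of basis whose first vector is the constant one, and its inverse. All rows of the
  -- all-ones matrix times `spread` coincide and `unspread` keeps only the first of them, so
  -- conjugation makes β I - μ J upper triangular.
  spread unspread : ∀ {q} → Fin q → Fin q → ℤ
  spread v zero    = 1ℤ
  spread v (suc u) = δ v (suc u)

  unspread zero    v = δ zero v
  unspread (suc u) v = δ (suc u) v - δ zero v

  unspread-spread : ∀ {q} (u w : Fin q) → sum (λ v → unspread u v * spread v w) ≡ δ u w
  unspread-spread {suc q} zero zero = ∑-δˡ {suc q} zero (λ v → spread v zero)
  unspread-spread zero    (suc w) = ∑-δˡ zero (λ v → spread v (suc w))
  unspread-spread (suc u) zero    = ∑-δ-difference (suc u) zero (λ v → spread v zero)
  unspread-spread (suc u) (suc w) = trans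
    (∑-δ-difference (suc u) zero (λ v → spread v (suc w))) (ℤ.+-identityʳ _)

  sum-unspread : ∀ {q} (u : Fin (suc q)) → sum (unspread u) ≡ δ u zero
  sum-unspread u = trans (∑.sum-cong-≗ λ v → sym (ℤ.*-identityʳ (unspread u v))) (unspread-spread u zero)

  module _ {n q : ℕ} where

    Z : Array (suc n) (suc q)
    Z i u j v = differences i j * δ u v

    Z-⊙₂ : ∀ M i u j v → (Z ⊙₂ M) i u j v ≡ sum (λ k → differences i k * M k u j v)
    Z-⊙₂ M i u j v = ∑.sum-cong-≗ λ k → begin
      sum (λ w → differences i k * δ u w * M k w j v)
        ≡⟨ ∑.sum-cong-≗ (λ w → ℤ.*-assoc (differences i k) (δ u w) (M k w j v)) ⟩
      sum (λ w → differences i k * (δ u w * M k w j v))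
        ≡⟨ ∑.*-distribˡ-sum (differences i k) (λ w → δ u w * M k w j v) ⟨
      differences i k * sum (λ w → δ u w * M k w j v)
        ≡⟨ cong (differences i k *_) (∑-δˡ u (λ w → M k w j v)) ⟩
      differences i k * M k u j v ∎

    private
      E R : Array (suc n) (suc q)
      E i u j v = tails i j * spread u v
      R i u j v = δ i j * unspread u v

    -- The product of `R`, `Y` and `E` is upper triangular: the `tails` in `E` clear everything
    -- below the first block row except identity blocks on the diagonal. Since the first column of
    -- `tails` is constant, the corner block only involves the sum of the first block row of `Y`,
    -- which is why `top` prescribes nothing but that sum. `spread` and `unspread` then
    -- triangularise the corner.
    module _ (Y : Array (suc n) (suc q)) (β μ : ℤ)
      (top : ∀ u v → sum (λ j → Y zero u j v) ≡ β * δ u v - μ)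
      (low : ∀ i u j v → Y (suc i) u j v ≡ differences (suc i) j * δ u v) where

      private
        YE-low : ∀ i u j v → (Y ⊙₂ E) (suc i) u j v ≡ δ (suc i) j * spread u v
        YE-low i u j v = begin
          (Y ⊙₂ E) (suc i) u j v
            ≡⟨ ∑∑-cong (λ k w → trans (cong (_* (tails k j * spread w v)) (low i u k w))
                 (arith (differences (suc i) k) (δ u w) (tails k j) (spread w v))) ⟩
          sum (λ k → sum λ w → (differences (suc i) k * tails k j) * (δ u w * spread w v))
            ≡⟨ ∑.sum-cong-≗ (λ k → trans
                 (sym (∑.*-distribˡ-sum (differences (suc i) k * tails k j) (λ w → δ u w * spread w v)))
                 (cong ((differences (suc i) k * tails k j) *_) (∑-δˡ u (λ w → spread w v)))) ⟩
          sum (λ k → (differences (suc i) k * tails k j) * spread u v)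
            ≡⟨ ∑.*-distribʳ-sum (spread u v) (λ k → differences (suc i) k * tails k j) ⟨
          sum (λ k → differences (suc i) k * tails k j) * spread u v
            ≡⟨ cong (_* spread u v) (trans (∑-δ-difference (suc i) (inject₁ i) (λ k → tails k j)) (tails-step i j)) ⟩
          δ (suc i) j * spread u v ∎
          where
          arith : ∀ a b c d → a * b * (c * d) ≡ (a * c) * (b * d)
          arith = solve-∀

        YE-corner : ∀ u v → (Y ⊙₂ E) zero u zero v ≡ β * spread u v - μ * sum (λ w → spread w v)
        YE-corner u v = begin
          (Y ⊙₂ E) zero u zero v
            ≡⟨ ∑.∑-comm (λ k w → Y zero u k w * (1ℤ * spread w v)) ⟩
          sum (λ w → sum λ k → Y zero u k w * (1ℤ * spread w v))
            ≡⟨ ∑.sum-cong-≗ (λ w → trans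
                 (sym (∑.*-distribʳ-sum (1ℤ * spread w v) (λ k → Y zero u k w)))
                 (trans (cong (_* (1ℤ * spread w v)) (top u w)) (arith β (δ u w) μ (spread w v)))) ⟩
          sum (λ w → β * (δ u w * spread w v) - μ * spread w v)
            ≡⟨ ∑-difference (λ w → β * (δ u w * spread w v)) (λ w → μ * spread w v) ⟩
          sum (λ w → β * (δ u w * spread w v)) - sum (λ w → μ * spread w v)
            ≡⟨ cong₂ _-_
                 (trans (sym (∑.*-distribˡ-sum β (λ w → δ u w * spread w v)))
                   (cong (β *_) (∑-δˡ u (λ w → spread w v))))
                 (sym (∑.*-distribˡ-sum μ (λ w → spread w v))) ⟩
          β * spread u v - μ * sum (λ w → spread w v) ∎
          where
          arith : ∀ b d m s → (b * d - m) * (1ℤ * s) ≡ b * (d * s) - m * s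
          arith = solve-∀

        T : Array (suc n) (suc q)
        T = R ⊙₂ (Y ⊙₂ E)

        T-row : ∀ i u j v → T i u j v ≡ sum (λ w → unspread u w * (Y ⊙₂ E) i w j v)
        T-row i u j v = begin
          T i u j v
            ≡⟨ ∑.∑-comm (λ k w → R i u k w * (Y ⊙₂ E) k w j v) ⟩
          sum (λ w → sum λ k → δ i k * unspread u w * (Y ⊙₂ E) k w j v)
            ≡⟨ ∑∑-cong (λ w k → ℤ.*-assoc (δ i k) (unspread u w) ((Y ⊙₂ E) k w j v)) ⟩
          sum (λ w → sum λ k → δ i k * (unspread u w * (Y ⊙₂ E) k w j v))
            ≡⟨ ∑.sum-cong-≗ (λ w → ∑-δˡ i (λ k → unspread u w * (Y ⊙₂ E) k w j v)) ⟩
          sum (λ w → unspread u w * (Y ⊙₂ E) i w j v) ∎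

        T-low : ∀ i u j v → T (suc i) u j v ≡ δ (suc i) j * δ u v
        T-low i u j v = begin
          T (suc i) u j v
            ≡⟨ T-row (suc i) u j v ⟩
          sum (λ w → unspread u w * (Y ⊙₂ E) (suc i) w j v)
            ≡⟨ ∑.sum-cong-≗ (λ w → trans (cong (unspread u w *_) (YE-low i w j v))
                 (arith (unspread u w) (δ (suc i) j) (spread w v))) ⟩
          sum (λ w → δ (suc i) j * (unspread u w * spread w v))
            ≡⟨ ∑.*-distribˡ-sum (δ (suc i) j) (λ w → unspread u w * spread w v) ⟨
          δ (suc i) j * sum (λ w → unspread u w * spread w v)
            ≡⟨ cong (δ (suc i) j *_) (unspread-spread u v) ⟩
          δ (suc i) j * δ u v ∎
          where
          arith : ∀ a b c → a * (b * c) ≡ b * (a * c)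
          arith = solve-∀

        T-corner : ∀ u v → T zero u zero v ≡ β * δ u v - δ u zero * (μ * sum (λ w → spread w v))
        T-corner u v = begin
          T zero u zero v
            ≡⟨ T-row zero u zero v ⟩
          sum (λ w → unspread u w * (Y ⊙₂ E) zero w zero v)
            ≡⟨ ∑.sum-cong-≗ (λ w → trans (cong (unspread u w *_) (YE-corner w v))
                 (arith (unspread u w) β (spread w v) s)) ⟩
          sum (λ w → β * (unspread u w * spread w v) - unspread u w * s)
            ≡⟨ ∑-difference (λ w → β * (unspread u w * spread w v)) (λ w → unspread u w * s) ⟩
          sum (λ w → β * (unspread u w * spread w v)) - sum (λ w → unspread u w * s)
            ≡⟨ cong₂ _-_
                 (trans (sym (∑.*-distribˡ-sum β (λ w → unspread u w * spread w v)))
                   (cong (β *_) (unspread-spread u v)))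
                 (trans (sym (∑.*-distribʳ-sum s (unspread u))) (cong (_* s) (sum-unspread u))) ⟩
          β * δ u v - δ u zero * s ∎
          where
          s = μ * sum (λ w → spread w v)
          arith : ∀ a b c s → a * (b * c - s) ≡ b * (a * c) - a * s
          arith = solve-∀

        below : ∀ i u j v → j Fin.< i → T i u j v ≡ 0ℤ
        below (suc i) u j v j<i = trans (T-low i u j v)
          (trans (cong (_* δ u v) (δ-≢ {i = suc i} {j} λ i≡j → ℕ.<-irrefl (cong toℕ (sym i≡j)) j<i)) (ℤ.*-zeroˡ (δ u v)))

        inside : ∀ i u v → v Fin.< u → T i u i v ≡ 0ℤ
        inside zero (suc u) v v<u = trans (T-corner (suc u) v)
          (trans (cong (λ x → β * x - 0ℤ * (μ * sum (λ w → spread w v)))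
            (δ-≢ {i = suc u} {v} λ u≡v → ℕ.<-irrefl (cong toℕ (sym u≡v)) v<u))
            (arith β (μ * sum (λ w → spread w v))))
          where
          arith : ∀ b s → b * 0ℤ - 0ℤ * s ≡ 0ℤ
          arith = solve-∀
        inside (suc i) u v v<u = trans (T-low i u (suc i) v)
          (trans (cong (δ i i *_) (δ-≢ {i = u} {v} λ u≡v → ℕ.<-irrefl (cong toℕ (sym u≡v)) v<u)) (ℤ.*-zeroʳ (δ i i)))

        diagonal-zero : product (λ u → T zero u zero u) ≡ (β - μ * ℤ.+ suc q) * β ^ q
        diagonal-zero = cong₂ _*_
          (trans (T-corner zero zero)
            (trans (cong (λ x → β * 1ℤ - 1ℤ * (μ * x)) (trans (∑-const (suc q) 1ℤ) (ℤ.*-identityʳ _))) (arith β (μ * ℤ.+ suc q))))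
          (trans (∏.sum-cong-≗ {q} λ u → trans (T-corner (suc u) (suc u))
            (trans (cong (λ x → β * x - 0ℤ * (μ * sum (λ w → spread w (suc u)))) (δ-refl u))
              (arith′ β (μ * sum (λ w → spread w (suc u))))))
            (∏-const q β))
          where
          arith : ∀ b x → b * 1ℤ - 1ℤ * x ≡ b - x
          arith = solve-∀
          arith′ : ∀ b x → b * 1ℤ - 0ℤ * x ≡ b
          arith′ = solve-∀

        diagonal-suc : ∀ i → product (λ u → T (suc i) u (suc i) u) ≡ 1ℤ
        diagonal-suc i = trans (∏.sum-cong-≗ {suc q} λ u → trans (T-low i u (suc i) u) (cong₂ _*_ (δ-refl i) (δ-refl u)))
          (∏.sum-replicate-zero (suc q))

      det-blocks : det₂ R * (det₂ Y * det₂ E) ≡ (β - μ * ℤ.+ suc q) * β ^ q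
      det-blocks = begin
        det₂ R * (det₂ Y * det₂ E)   ≡⟨ cong (det₂ R *_) (det₂-⊙₂ Y E) ⟨
        det₂ R * det₂ (Y ⊙₂ E)       ≡⟨ det₂-⊙₂ R (Y ⊙₂ E) ⟨
        det₂ T                       ≡⟨ det₂-upperTriangular T below inside ⟩
        product (λ i → product (λ u → T i u i u))
          ≡⟨ cong₂ _*_ diagonal-zero
               (trans (∏.sum-cong-≗ {n} diagonal-suc) (∏.sum-replicate-zero n)) ⟩
        (β - μ * ℤ.+ suc q) * β ^ q * 1ℤ ≡⟨ ℤ.*-identityʳ _ ⟩
        (β - μ * ℤ.+ suc q) * β ^ q  ∎

    -- Z itself has the shape of Y, so that det₂ Z and the determinants of the
    -- auxiliary row and column operations cancel.
    det-from-differences : (M Y : Array (suc n) (suc q)) (β μ : ℤ) →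
      det₂ (Z ⊙₂ M) ≡ det₂ Y →
      (∀ u v → sum (λ j → Y zero u j v) ≡ β * δ u v - μ) →
      (∀ i u j v → Y (suc i) u j v ≡ differences (suc i) j * δ u v) →
      (ℤ.+ suc n) ^ suc q * det₂ M ≡ (β - μ * ℤ.+ suc q) * β ^ q
    det-from-differences M Y β μ eq top low = begin
      N * N ^ q * det₂ M                   ≡⟨ cong (λ x → x * N ^ q * det₂ M) (arith₁ N (ℤ.+ suc q)) ⟩
      (N - 0ℤ * ℤ.+ suc q) * N ^ q * det₂ M
        ≡⟨ cong (_* det₂ M) (det-blocks Z N 0ℤ top-Z (λ _ _ _ _ → refl)) ⟨
      det₂ R * (det₂ Z * det₂ E) * det₂ M  ≡⟨ arith₂ (det₂ R) (det₂ Z) (det₂ E) (det₂ M) ⟩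
      det₂ R * (det₂ Z * det₂ M * det₂ E)  ≡⟨ cong (λ x → det₂ R * (x * det₂ E)) (trans (sym (det₂-⊙₂ Z M)) eq) ⟩
      det₂ R * (det₂ Y * det₂ E)           ≡⟨ det-blocks Y β μ top low ⟩
      (β - μ * ℤ.+ suc q) * β ^ q          ∎
      where
      N = ℤ.+ suc n
      arith₁ : ∀ x y → x ≡ x - 0ℤ * y
      arith₁ = solve-∀
      arith₂ : ∀ r z e m → r * (z * e) * m ≡ r * (z * m * e)
      arith₂ = solve-∀
      arith₃ : ∀ x d → x * (1ℤ * d) ≡ x * d - 0ℤ
      arith₃ = solve-∀
      top-Z : ∀ u v → sum (λ j → Z zero u j v) ≡ N * δ u v - 0ℤ
      top-Z u v = trans (∑-const (suc n) (1ℤ * δ u v)) (arith₃ N (δ u v))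

-- Integer indicators of decidable propositions.

module Indicators where

  open Determinants
  open import Data.Fin.Base using (Fin; toℕ)
  open import Data.Integer.Base as ℤ using (ℤ; 0ℤ; 1ℤ; _+_; _-_)
  import Data.Integer.Properties as ℤ
  open import Data.Integer.Tactic.RingSolver using (solve-∀)
  open import Data.Nat.Base using (ℕ; zero; suc)
  open import Function.Base using (_∘_)
  open import Function.Bundles using (Inverse)
  open import Relation.Binary.Bundles using (Setoid)
  open import Relation.Binary.PropositionalEquality as ≡ using (_≡_; refl; cong)
  open import Relation.Nullary using (¬_; Dec; yes; no; contradiction)
  open ∑ using (sum)

  ⟦_⟧ : ∀ {p} {P : Set p} → Dec P → ℤ
  ⟦ yes _ ⟧ = 1ℤ
  ⟦ no  _ ⟧ = 0ℤ

  ⟦⟧-⇔ : ∀ {p q} {P : Set p} {Q : Set q} (P? : Dec P) (Q? : Dec Q) → (P → Q) → (Q → P) → ⟦ P? ⟧ ≡ ⟦ Q? ⟧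
  ⟦⟧-⇔ (yes p) (yes q) P⇒Q Q⇒P = refl
  ⟦⟧-⇔ (yes p) (no ¬q) P⇒Q Q⇒P = contradiction (P⇒Q p) ¬q
  ⟦⟧-⇔ (no ¬p) (yes q) P⇒Q Q⇒P = contradiction (Q⇒P q) ¬p
  ⟦⟧-⇔ (no ¬p) (no ¬q) P⇒Q Q⇒P = refl

  ⟦⟧-yes : ∀ {p} {P : Set p} (P? : Dec P) → P → ⟦ P? ⟧ ≡ 1ℤ
  ⟦⟧-yes (yes _) p = refl
  ⟦⟧-yes (no ¬p) p = contradiction p ¬p

  ⟦⟧-no : ∀ {p} {P : Set p} (P? : Dec P) → ¬ P → ⟦ P? ⟧ ≡ 0ℤ
  ⟦⟧-no (yes p) ¬p = contradiction p ¬p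
  ⟦⟧-no (no _)  ¬p = refl

  ⟦⟧-δ : ∀ {p n} {P : Set p} (P? : Dec P) (i j : Fin n) → (P → i ≡ j) → (i ≡ j → P) → ⟦ P? ⟧ ≡ δ i j
  ⟦⟧-δ (yes p) i j P⇒≡ ≡⇒P = ≡.sym (δ-≡ (P⇒≡ p))
  ⟦⟧-δ (no ¬p) i j P⇒≡ ≡⇒P = ≡.sym (δ-≢ (¬p ∘ ≡⇒P))

  telescope : ∀ n (f : ℕ → ℤ) → sum {n} (λ k → f (toℕ k) - f (suc (toℕ k))) ≡ f 0 - f n
  telescope zero    f = ≡.sym (ℤ.+-inverseʳ (f 0))
  telescope (suc n) f = ≡.trans (cong (f 0 - f 1 +_) (telescope n (f ∘ suc))) (arith (f 0) (f 1) (f (suc n)))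
    where
    arith : ∀ x y z → x - y + (y - z) ≡ x - z
    arith = solve-∀

  module _ {c ℓ} {S : Setoid c ℓ} {n} (e : Inverse (≡.setoid (Fin n)) S) where
    open Setoid S using (_≈_; Carrier; sym)
    private module E = Inverse e

    ∑-⟦⟧-unique : ∀ {p} {P : Fin n → Set p} (P? : ∀ j → Dec (P j)) (x : Carrier) →
                  (∀ j → P j → E.to j ≈ x) → (∀ j → E.to j ≈ x → P j) → sum (λ j → ⟦ P? j ⟧) ≡ 1ℤ
    ∑-⟦⟧-unique P? x P⇒ ⇒P = ≡.trans
      (∑.sum-cong-≗ λ j → ≡.trans
        (⟦⟧-δ (P? j) (E.from x) j (λ p → E.inverseʳ (sym (P⇒ j p))) (λ eq → ⇒P j (E.inverseˡ (≡.sym eq))))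
        (≡.sym (ℤ.*-identityʳ _)))
      (∑-δˡ (E.from x) (λ _ → 1ℤ))

-- Orders of elements and a criterion for a finite abelian group to be cyclic.

module CyclicGroups where

  open import Algebra.Bundles using (AbelianGroup)
  import Algebra.Properties.CommutativeMonoid.Mult as MonoidMult
  import Algebra.Properties.CommutativeMonoid.Sum as MonoidSum
  import Algebra.Properties.Group as GroupProperties
  open import Data.Fin.Base as Fin using (Fin; zero; suc; toℕ; punchOut; combine; remQuot)
  import Data.Fin.Permutation as Permutation
  import Data.Fin.Properties as Fin
  open import Data.List.Base using ([]; _∷_)
  open import Data.List.Relation.Unary.All using ([]; _∷_)
  open import Data.Nat.Base as ℕ using (ℕ; zero; suc; NonZero; NonTrivial)
  open import Data.Nat.Coprimality as Coprimality using (Coprime)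
  open import Data.Nat.Divisibility
  open import Data.Nat.GCD using (module Bézout)
  open import Data.Nat.Induction using (<-rec)
  open import Data.Nat.Primality
  open import Data.Nat.Primality.Factorisation using (factorise)
  import Data.Nat.Properties as ℕ
  open import Data.Nat.Tactic.RingSolver using (solve-∀)
  open import Data.Product.Base using (∃; ∃₂; _×_; _,_; proj₁; proj₂)
  open import Data.Product.Relation.Binary.Pointwise.NonDependent using (_×ₛ_)
  open import Data.Sum.Base using (inj₁; inj₂)
  open import Function.Base using (_∘_)
  open import Function.Bundles using (Inverse)
  open import Function.Definitions using (Injective)
  open import Relation.Binary.Bundles using (Setoid)
  open import Relation.Binary.PropositionalEquality as ≡ using (_≡_; refl; cong; cong₂; subst)
  import Relation.Binary.Reasoning.Setoid as ≈-Reasoning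
  open import Relation.Nullary using (¬_; yes; no; contradiction)

  ∤⇒coprime : ∀ {r c} → Prime r → ¬ r ∣ c → Coprime r c
  ∤⇒coprime r-prime r∤c (d∣r , d∣c) with prime⇒irreducible r-prime d∣r
  ... | inj₁ d≡1 = d≡1
  ... | inj₂ refl = contradiction d∣c r∤c

  coprime-^ : ∀ {m r} → Coprime m r → ∀ k → Coprime m (r ℕ.^ k)
  coprime-^ c zero    (d∣m , d∣1) = ∣1⇒≡1 d∣1
  coprime-^ c (suc k) (d∣m , d∣r^k) = coprime-^ c k
    (d∣m , Coprimality.coprime-divisor (λ (e∣d , e∣r) → c (∣-trans e∣d d∣m , e∣r)) d∣r^k)

  remove-prime : ∀ {r} → Prime r → ∀ d → .{{NonZero d}} → ∃₂ λ k d′ → d ≡ r ℕ.^ k ℕ.* d′ × ¬ r ∣ d′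
  remove-prime {r} r-prime = <-rec (λ d → .{{NonZero d}} → ∃₂ λ k d′ → d ≡ r ℕ.^ k ℕ.* d′ × ¬ r ∣ d′) step
    where
    instance
      _ = prime⇒nonTrivial r-prime
    step : ∀ d → (∀ {c} → c ℕ.< d → .{{NonZero c}} → ∃₂ λ k d′ → c ≡ r ℕ.^ k ℕ.* d′ × ¬ r ∣ d′) →
           .{{NonZero d}} → ∃₂ λ k d′ → d ≡ r ℕ.^ k ℕ.* d′ × ¬ r ∣ d′
    step d rec with r ∣? d
    ... | no r∤d = 0 , d , ≡.sym (ℕ.+-identityʳ d) , r∤d
    ... | yes (divides zero refl) = contradiction refl (ℕ.≢-nonZero⁻¹ 0)
    ... | yes (divides c@(suc _) refl) with rec (ℕ.m<m*n c r (ℕ.nonTrivial⇒n>1 r))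
    ...   | k , d′ , c≡ , r∤d′ = suc k , d′ , ≡.trans (cong (ℕ._* r) c≡) (arith (r ℕ.^ k) d′ r) , r∤d′
      where
      arith : ∀ x y z → x ℕ.* y ℕ.* z ≡ z ℕ.* x ℕ.* y
      arith = solve-∀

  prime-divisor : ∀ d → .{{NonTrivial d}} → ∃ λ r → Prime r × r ∣ d
  prime-divisor d with factorise d {{ℕ.nonTrivial⇒nonZero d}}
  ... | record { factors = [] ; isFactorisation = refl } = contradiction refl (ℕ.nonTrivial⇒≢1 {1})
  ... | record { factors = r ∷ rs ; isFactorisation = eq ; factorsPrime = r-prime ∷ _ } =
    r , r-prime , subst (r ∣_) (≡.sym eq) (m∣m*n _)

  -- Pigeonhole: if `j` were missed, punching it out would inject `Fin (suc n)` into `Fin n`.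
  injective⇒surjective : ∀ {n} {f : Fin n → Fin n} → Injective _≡_ _≡_ f → ∀ j → ∃ λ i → f i ≡ j
  injective⇒surjective {suc n} {f} f-injective j with Fin.any? (λ i → f i Fin.≟ j)
  ... | yes found = found
  ... | no  none  = contradiction
    (Fin.injective⇒≤ {f = λ i → punchOut (λ j≡fi → none (i , ≡.sym j≡fi))}
      (f-injective ∘ Fin.punchOut-injective {i = j} _ _))
    ℕ.1+n≰n

  module _ {c ℓ} {S : Setoid c ℓ} {n} (e : Inverse (≡.setoid (Fin n)) S) where
    open Setoid S hiding (refl)
    private module E = Inverse e

    inverse-of-injective : (f : Fin n → Carrier) → (∀ i j → f i ≈ f j → i ≡ j) → Inverse (≡.setoid (Fin n)) S
    inverse-of-injective f f-injective = record
      { to        = f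
      ; from      = λ x → proj₁ (preimage x)
      ; to-cong   = λ { refl → Setoid.refl S }
      ; from-cong = λ {x} {y} x≈y → f-injective _ _
          (trans (f-preimage x) (trans x≈y (sym (f-preimage y))))
      ; inverse   = (λ { {x} refl → f-preimage x })
                  , (λ {i} {x} x≈fi → f-injective _ _ (trans (f-preimage x) x≈fi))
      }
      where
      preimage : ∀ x → ∃ λ i → E.from (f i) ≡ E.from x
      preimage x = injective⇒surjective
        (λ {i} {j} eq → f-injective i j (trans (sym (E.strictlyInverseˡ (f i)))
          (trans (E.to-cong eq) (E.strictlyInverseˡ (f j))))) (E.from x)
      f-preimage : ∀ x → f (proj₁ (preimage x)) ≈ x
      f-preimage x = trans (sym (E.strictlyInverseˡ _))
        (trans (E.to-cong (proj₂ (preimage x))) (E.strictlyInverseˡ x))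

  module _ {c₁ ℓ₁ c₂ ℓ₂} {S : Setoid c₁ ℓ₁} {T : Setoid c₂ ℓ₂} {m n}
    (e : Inverse (≡.setoid (Fin m)) S) (f : Inverse (≡.setoid (Fin n)) T) where
    private
      module S = Setoid S
      module T = Setoid T
      module E = Inverse e
      module F = Inverse f

    -- `to` goes through `remQuot` exactly as `flatten` does, so a determinant over this enumeration
    -- is a `det₂` by computation.
    enumerate-× : Inverse (≡.setoid (Fin (m ℕ.* n))) (S ×ₛ T)
    enumerate-× = record
      { to        = λ r → E.to (proj₁ (remQuot {m} n r)) , F.to (proj₂ (remQuot {m} n r))
      ; from      = λ (x , y) → combine (E.from x) (F.from y)
      ; to-cong   = λ { refl → S.refl , T.refl }
      ; from-cong = λ (p , q) → cong₂ combine (E.from-cong p) (F.from-cong q)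
      ; inverse   =
          (λ { {x , y} refl → E.inverseˡ (cong proj₁ (Fin.remQuot-combine (E.from x) (F.from y)))
                            , F.inverseˡ (cong proj₂ (Fin.remQuot-combine (E.from x) (F.from y))) })
        , (λ {r} (p , q) → ≡.trans (cong₂ combine (E.inverseʳ p) (F.inverseʳ q)) (Fin.combine-remQuot {m} n r))
      }

  module AbelianPowers {c ℓ} (G : AbelianGroup c ℓ) where
    open AbelianGroup G hiding (refl)
    open ≈-Reasoning setoid
    open GroupProperties group using (∙-cancelʳ; ∙-cancelˡ)
    private
      module Mult = MonoidMult commutativeMonoid
      module Prod = MonoidSum commutativeMonoid

    infixr 8 _^_

    _^_ : Carrier → ℕ → Carrier
    x ^ k = k Mult.× x

    ^-cong : ∀ k {x y} → x ≈ y → x ^ k ≈ y ^ k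
    ^-cong = Mult.×-congʳ

    ^-+ : ∀ x k l → x ^ (k ℕ.+ l) ≈ x ^ k ∙ x ^ l
    ^-+ = Mult.×-homo-+

    ^-^ : ∀ x k l → (x ^ k) ^ l ≈ x ^ (k ℕ.* l)
    ^-^ x k l = trans (Mult.×-assocˡ x l k) (reflexive (cong (x ^_) (ℕ.*-comm l k)))

    ε^ : ∀ k → ε ^ k ≈ ε
    ε^ zero    = AbelianGroup.refl G
    ε^ (suc k) = trans (identityˡ _) (ε^ k)

    ^-multiple : ∀ {x m k} → x ^ m ≈ ε → m ∣ k → x ^ k ≈ ε
    ^-multiple {x} {m} x^m≈ε (divides q ≡.refl) = begin
      x ^ (q ℕ.* m)  ≡⟨ cong (x ^_) (ℕ.*-comm q m) ⟩
      x ^ (m ℕ.* q)  ≈⟨ ^-^ x m q ⟨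
      (x ^ m) ^ q    ≈⟨ ^-cong q x^m≈ε ⟩
      ε ^ q          ≈⟨ ε^ q ⟩
      ε              ∎

    ^-coprime : ∀ {x m k} → Coprime m k → x ^ m ≈ ε → x ^ k ≈ ε → x ≈ ε
    ^-coprime {x} {m} {k} m⊥k x^m≈ε x^k≈ε with Coprimality.coprime-Bézout m⊥k
    -- Over ℕ the Bézout identity has two forms, 1 + b k = a m and 1 + a m = b k.
    ... | Bézout.+- a b eq = begin
        x                    ≈⟨ identityʳ x ⟨
        x ∙ ε                ≈⟨ ∙-congˡ (^-multiple x^k≈ε (n∣m*n b)) ⟨
        x ^ (1 ℕ.+ b ℕ.* k)  ≡⟨ cong (x ^_) eq ⟩
        x ^ (a ℕ.* m)        ≈⟨ ^-multiple x^m≈ε (n∣m*n a) ⟩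
        ε                    ∎
    ... | Bézout.-+ a b eq = begin
        x                    ≈⟨ identityʳ x ⟨
        x ∙ ε                ≈⟨ ∙-congˡ (^-multiple x^m≈ε (n∣m*n a)) ⟨
        x ^ (1 ℕ.+ a ℕ.* m)  ≡⟨ cong (x ^_) eq ⟩
        x ^ (b ℕ.* k)        ≈⟨ ^-multiple x^k≈ε (n∣m*n b) ⟩
        ε                    ∎

    -- Minimality is phrased by divisibility, the form in which coprimality arguments use and
    -- produce it.
    record HasOrder (x : Carrier) (d : ℕ) : Set ℓ where
      field
        ^-order : x ^ d ≈ ε
        minimal : ∀ m → x ^ m ≈ ε → d ∣ m

    ε-order : HasOrder ε 1
    ε-order = record { ^-order = ε^ 1 ; minimal = λ m _ → 1∣ m }

    -- If `x ∙ y` has trivial `m`-th power, raising to the power `e` removes `y`, so d divides e m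
    -- and hence m; symmetrically for e. Coprime divisors of m multiply.
    ∙-order : ∀ {x y d e} → Coprime d e → HasOrder x d → HasOrder y e → HasOrder (x ∙ y) (d ℕ.* e)
    ∙-order {x} {y} {d} {e} d⊥e X Y = record
      { ^-order = begin
          (x ∙ y) ^ (d ℕ.* e)            ≈⟨ Mult.×-distrib-+ x y (d ℕ.* e) ⟩
          x ^ (d ℕ.* e) ∙ y ^ (d ℕ.* e)  ≈⟨ ∙-cong (^-multiple {x} {d} X.^-order (m∣m*n e)) (^-multiple {y} {e} Y.^-order (n∣m*n d)) ⟩
          ε ∙ ε                          ≈⟨ identityˡ ε ⟩
          ε                              ∎
      ; minimal = minimal
      }
      where
      module X = HasOrder X
      module Y = HasOrder Y
      x-part : ∀ m → (x ∙ y) ^ m ≈ ε → d ∣ m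
      x-part m eq = Coprimality.coprime-divisor d⊥e (X.minimal (e ℕ.* m) (begin
        x ^ (e ℕ.* m)                  ≈⟨ identityʳ _ ⟨
        x ^ (e ℕ.* m) ∙ ε              ≈⟨ ∙-congˡ (^-multiple {y} {e} Y.^-order (m∣m*n m)) ⟨
        x ^ (e ℕ.* m) ∙ y ^ (e ℕ.* m)  ≈⟨ Mult.×-distrib-+ x y (e ℕ.* m) ⟨
        (x ∙ y) ^ (e ℕ.* m)            ≈⟨ ^-multiple eq (n∣m*n e) ⟩
        ε                              ∎))
      y-part : ∀ m → (x ∙ y) ^ m ≈ ε → e ∣ m
      y-part m eq = Coprimality.coprime-divisor (Coprimality.sym d⊥e) (Y.minimal (d ℕ.* m) (begin
        y ^ (d ℕ.* m)                  ≈⟨ identityˡ _ ⟨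
        ε ∙ y ^ (d ℕ.* m)              ≈⟨ ∙-congʳ (^-multiple {x} {d} X.^-order (m∣m*n m)) ⟨
        x ^ (d ℕ.* m) ∙ y ^ (d ℕ.* m)  ≈⟨ Mult.×-distrib-+ x y (d ℕ.* m) ⟨
        (x ∙ y) ^ (d ℕ.* m)            ≈⟨ ^-multiple eq (n∣m*n d) ⟩
        ε                              ∎))
      minimal : ∀ m → (x ∙ y) ^ m ≈ ε → d ℕ.* e ∣ m
      minimal m eq with x-part m eq
      ... | divides c ≡.refl = subst (d ℕ.* e ∣_) (ℕ.*-comm d c) (*-monoʳ-∣ d
        (Coprimality.coprime-divisor (Coprimality.sym d⊥e)
          (subst (e ∣_) (ℕ.*-comm c d) (y-part m eq))))

    coprime-^-order : ∀ {x d a} → Coprime a d → HasOrder x d → HasOrder (x ^ a) d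
    coprime-^-order {x} {d} {a} a⊥d X = record
      { ^-order = trans (^-^ x a d) (^-multiple {x} {d} X.^-order (n∣m*n a))
      ; minimal = λ m eq → Coprimality.coprime-divisor (Coprimality.sym a⊥d)
          (X.minimal (a ℕ.* m) (trans (sym (^-^ x a m)) eq))
      }
      where module X = HasOrder X

    module _ {r} (r-prime : Prime r) where

      prime-∣ : ∀ {v} → v ^ r ≈ ε → ¬ v ≈ ε → ∀ m → v ^ m ≈ ε → r ∣ m
      prime-∣ v^r≈ε v≉ε m v^m≈ε with r ∣? m
      ... | yes r∣m = r∣m
      ... | no  r∤m = contradiction (^-coprime (∤⇒coprime r-prime r∤m) v^r≈ε v^m≈ε) v≉ε

      -- In the step to `suc k`, induction for `x ^ r` gives m = c r ^ k; then `x ^ (r ℕ.^ k)` is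
      -- nontrivial with trivial `r`-th power, and its `c`-th power is trivial too, so r divides c.
      -- The equation `k ≡ suc k′` makes the second hypothesis vacuous for exponent zero.
      prime-power-∣ : ∀ k {x} → x ^ (r ℕ.^ k) ≈ ε → (∀ k′ → k ≡ suc k′ → ¬ x ^ (r ℕ.^ k′) ≈ ε) →
                      ∀ m → x ^ m ≈ ε → r ℕ.^ k ∣ m
      prime-power-∣ zero    _ _ m _ = 1∣ m
      prime-power-∣ (suc k) {x} x^r^k≈ε ≉ε m x^m≈ε
        with prime-power-∣ k (trans (^-^ x r (r ℕ.^ k)) x^r^k≈ε)
               (λ { k′ ≡.refl eq → ≉ε _ ≡.refl (trans (sym (^-^ x r (r ℕ.^ k′))) eq) })
               m (trans (^-^ x r m) (^-multiple x^m≈ε (n∣m*n r)))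
      ... | divides c ≡.refl = *-monoˡ-∣ (r ℕ.^ k)
        (prime-∣ {x ^ (r ℕ.^ k)}
          (trans (^-^ x (r ℕ.^ k) r) (trans (reflexive (cong (x ^_) (ℕ.*-comm (r ℕ.^ k) r))) x^r^k≈ε))
          (≉ε k ≡.refl) c
          (trans (^-^ x (r ℕ.^ k) c) (trans (reflexive (cong (x ^_) (ℕ.*-comm (r ℕ.^ k) c))) x^m≈ε)))

      prime-power-order : ∀ k {x} → x ^ (r ℕ.^ suc k) ≈ ε → ¬ x ^ (r ℕ.^ k) ≈ ε → HasOrder x (r ℕ.^ suc k)
      prime-power-order k eq ≉ε = record
        { ^-order = eq
        ; minimal = prime-power-∣ (suc k) eq λ { _ ≡.refl → ≉ε }
        }

    <-powers-injective : ∀ {x n i j} → HasOrder x n → i ℕ.≤ j → j ℕ.< n → x ^ i ≈ x ^ j → i ≡ j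
    <-powers-injective {x} {n} {i} {j} X i≤j j<n eq with j ℕ.∸ i in d≡
    ... | zero  = ℕ.≤-antisym i≤j (ℕ.m∸n≡0⇒m≤n d≡)
    ... | suc d = contradiction
      (HasOrder.minimal X (suc d) (∙-cancelˡ (x ^ i) _ _ (begin
        x ^ i ∙ x ^ suc d        ≈⟨ ^-+ x i (suc d) ⟨
        x ^ (i ℕ.+ suc d)        ≡⟨ cong (λ k → x ^ (i ℕ.+ k)) d≡ ⟨
        x ^ (i ℕ.+ (j ℕ.∸ i))    ≡⟨ cong (x ^_) (ℕ.m+[n∸m]≡n i≤j) ⟩
        x ^ j                    ≈⟨ eq ⟨
        x ^ i                    ≈⟨ identityʳ _ ⟨
        x ^ i ∙ ε                ∎)))
      (λ n∣d → ℕ.<⇒≱ (ℕ.≤-<-trans (subst (ℕ._≤ j) d≡ (ℕ.m∸n≤m j i)) j<n) (∣⇒≤ n∣d))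

    powers-injective : ∀ {x n} → HasOrder x n → ∀ (i j : Fin n) → x ^ toℕ i ≈ x ^ toℕ j → i ≡ j
    powers-injective {x} {n} X i j eq with ℕ.≤-total (toℕ i) (toℕ j)
    ... | inj₁ i≤j = Fin.toℕ-injective (<-powers-injective X i≤j (Fin.toℕ<n j) eq)
    ... | inj₂ j≤i = Fin.toℕ-injective (≡.sym (<-powers-injective X j≤i (Fin.toℕ<n i) (sym eq)))

    module _ {n} (enumeration : Inverse (≡.setoid (Fin n)) setoid) where
      private module E = Inverse enumeration

      -- Multiplication by `x` permutes the group, so the product of all elements absorbs a factor
      -- `x ^ n`.
      ^-card : ∀ x → x ^ n ≈ ε
      ^-card x = ∙-cancelʳ (Prod.sum E.to) _ _ (begin
        x ^ n ∙ Prod.sum E.to                         ≈⟨ ∙-congʳ (Prod.sum-replicate n) ⟨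
        Prod.sum {n} (λ _ → x) ∙ Prod.sum E.to        ≈⟨ Prod.∑-distrib-+ (λ _ → x) E.to ⟨
        Prod.sum (λ i → x ∙ E.to i)                   ≈⟨ Prod.sum-cong-≋ (λ i → E.strictlyInverseˡ (x ∙ E.to i)) ⟨
        Prod.sum (λ i → E.to (E.from (x ∙ E.to i)))   ≈⟨ Prod.sum-permute E.to translation ⟨
        Prod.sum E.to                                 ≈⟨ identityˡ _ ⟨
        ε ∙ Prod.sum E.to                             ∎)
        where
        translate : ∀ y z → y ∙ z ≈ ε → ∀ i → E.from (y ∙ E.to (E.from (z ∙ E.to i))) ≡ i
        translate y z yz≈ε i = ≡.trans (E.from-cong (begin
          y ∙ E.to (E.from (z ∙ E.to i))  ≈⟨ ∙-congˡ (E.strictlyInverseˡ _) ⟩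
          y ∙ (z ∙ E.to i)                ≈⟨ assoc y z _ ⟨
          y ∙ z ∙ E.to i                  ≈⟨ ∙-congʳ yz≈ε ⟩
          ε ∙ E.to i                      ≈⟨ identityˡ _ ⟩
          E.to i                          ∎)) (E.strictlyInverseʳ i)
        translation : Permutation.Permutation n n
        translation = Permutation.permutation (λ i → E.from (x ∙ E.to i)) (λ i → E.from (x ⁻¹ ∙ E.to i))
          (translate x (x ⁻¹) (inverseʳ x)) (translate (x ⁻¹) x (inverseˡ x))

      powers-enumerate : ∀ {x} → HasOrder x n → Inverse (≡.setoid (Fin n)) setoid
      powers-enumerate {x} X = inverse-of-injective enumeration (λ i → x ^ toℕ i) (powers-injective X)

      -- A maximal prime power r ^ suc k dividing d is the order of w ^ (n / r ^ suc k)
      -- for any w with w ^ (n / r) different from ε; orders multiply by coprimality.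
      cyclic : (∀ m → 0 ℕ.< m → m ℕ.< n → ∃ λ w → ¬ w ^ m ≈ ε) → ∃ λ x → HasOrder x n
      cyclic non-trivial = <-rec (λ d → d ∣ n → ∃ λ x → HasOrder x d) step n ∣-refl
        where
        instance
          n≢0 : NonZero n
          n≢0 = Fin.nonZeroIndex (E.from ε)

        step : ∀ d → (∀ {e} → e ℕ.< d → e ∣ n → ∃ λ x → HasOrder x e) → d ∣ n → ∃ λ x → HasOrder x d
        step zero          rec 0∣n = contradiction (0∣⇒≡0 0∣n) (ℕ.≢-nonZero⁻¹ n)
        step (suc zero)    rec _   = ε , ε-order
        step d@(suc (suc _)) rec (divides c n≡cd)
          with r , r-prime , r∣d ← prime-divisor d
          with remove-prime r-prime d
        ... | zero  , d′ , d≡ , r∤d′ = contradiction (subst (r ∣_) (≡.trans d≡ (ℕ.+-identityʳ d′)) r∣d) r∤d′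
        ... | suc k , d′ , d≡ , r∤d′ = y ∙ x , subst (HasOrder (y ∙ x)) (≡.sym d≡)
            (∙-order (Coprimality.sym (coprime-^ (Coprimality.sym (∤⇒coprime r-prime r∤d′)) (suc k))) Y (proj₂ found))
          where
          instance
            _ = prime⇒nonTrivial r-prime
            _ = prime⇒nonZero r-prime
            d′≢0 : NonZero d′
            d′≢0 = ℕ.≢-nonZero λ { ≡.refl → r∤d′ (r ∣0) }
            c≢0 : NonZero c
            c≢0 = ℕ.≢-nonZero λ { ≡.refl → ℕ.≢-nonZero⁻¹ n n≡cd }
            _ = ℕ.m^n≢0 r k
          found : ∃ λ x → HasOrder x d′
          found = rec
            (subst (d′ ℕ.<_) (≡.sym d≡) (subst (ℕ._< r ℕ.^ suc k ℕ.* d′) (ℕ.*-identityˡ d′)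
              (ℕ.*-monoˡ-< d′ (ℕ.<-≤-trans (ℕ.nonTrivial⇒n>1 r) (ℕ.m≤m*n r (r ℕ.^ k))))))
            (∣-trans (subst (d′ ∣_) (≡.sym d≡) (n∣m*n (r ℕ.^ suc k))) (divides c n≡cd))
          x = proj₁ found
          -- `t` is n / r ^ suc k and, below, `m` is n / r, both written as products.
          t = c ℕ.* d′
          m = t ℕ.* r ℕ.^ k
          arith : ∀ c d′ r s → c ℕ.* (r ℕ.* s ℕ.* d′) ≡ c ℕ.* d′ ℕ.* s ℕ.* r
          arith = solve-∀
          arith′ : ∀ t s r → t ℕ.* s ℕ.* r ≡ t ℕ.* (r ℕ.* s)
          arith′ = solve-∀
          n≡mr : n ≡ m ℕ.* r
          n≡mr = ≡.trans n≡cd (≡.trans (cong (c ℕ.*_) d≡) (arith c d′ r (r ℕ.^ k)))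
          instance
            _ = ℕ.m*n≢0 c d′
            m≢0 : NonZero m
            m≢0 = ℕ.m*n≢0 t (r ℕ.^ k)
          w = non-trivial m (ℕ.>-nonZero⁻¹ m) (subst (m ℕ.<_) (≡.sym n≡mr) (ℕ.m<m*n m r (ℕ.nonTrivial⇒n>1 r)))
          y = proj₁ w ^ t
          Y : HasOrder y (r ℕ.^ suc k)
          Y = prime-power-order r-prime k
            (trans (^-^ (proj₁ w) t (r ℕ.^ suc k))
              (trans (reflexive (cong (proj₁ w ^_) (≡.trans (≡.sym (arith′ t (r ℕ.^ k) r)) (≡.sym n≡mr)))) (^-card (proj₁ w))))
            (proj₂ w ∘ trans (sym (^-^ (proj₁ w) t (r ℕ.^ k))))

-- Zeros of polynomial functions and primitive roots of a finite field.

module FieldUnits {c ℓ₁ ℓ₂} (F : FiniteField c ℓ₁ ℓ₂) where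

  open import Defs using (module GeneralAffine)
  open CyclicGroups
  open import Algebra.Bundles using (AbelianGroup; CommutativeRing)
  import Algebra.Apartness.Properties.HeytingCommutativeRing as HeytingProperties
  import Algebra.Properties.Group as GroupProperties
  open import Data.Fin.Base as Fin using (Fin; zero; suc; inject≤)
  import Data.Fin.Properties as Fin
  open import Data.Nat.Base as ℕ using (ℕ; zero; suc)
  open import Data.Product.Base using (∃; _×_; _,_; proj₁; proj₂)
  open import Function.Base using (_∘_)
  open import Function.Bundles using (Inverse)
  open import Level using (_⊔_)
  open import Relation.Binary.Bundles using (Setoid)
  open import Relation.Binary.PropositionalEquality as ≡ using (_≡_)
  import Relation.Binary.Reasoning.Setoid as ≈-Reasoning
  open import Relation.Nullary using (¬_; yes; no; contradiction)
  open import Relation.Nullary.Decidable using (¬?; decidable-stable)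
  import Algebra.Solver.Ring.NaturalCoefficients.Default as NaturalSolver

  open FiniteField F hiding (zero)
  open GeneralAffine F
  open HeytingProperties heytingCommutativeRing using (1#0; x#0y#0→xy#0)
  open GroupProperties (CommutativeRing.+-group commutativeRing) using () renaming (x∙y⁻¹≈ε⇒x≈y to x-y≈0⇒x≈y)
  open ≈-Reasoning setoid
  open NaturalSolver (CommutativeRing.commutativeSemiring commutativeRing) using (solve; _:=_; _:+_; _:*_)

  unitGroup : AbelianGroup (c ⊔ ℓ₂) ℓ₁
  unitGroup = record
    { Carrier = Unit
    ; _≈_     = Setoid._≈_ UnitSetoid
    ; _∙_     = λ (a , a#0) (b , b#0) → a * b , x#0y#0→xy#0 a#0 b#0
    ; ε       = 1# , 1#0
    ; _⁻¹     = inv-unit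
    ; isAbelianGroup = record
      { isGroup = record
        { isMonoid = record
          { isSemigroup = record
            { isMagma = record
              { isEquivalence = Setoid.isEquivalence UnitSetoid
              ; ∙-cong        = *-cong
              }
            ; assoc = λ u v w → *-assoc (proj₁ u) (proj₁ v) (proj₁ w)
            }
          ; identity = (λ u → *-identityˡ (proj₁ u)) , (λ u → *-identityʳ (proj₁ u))
          }
        ; inverse = inv-inverseˡ , inv-inverseʳ
        ; ⁻¹-cong = λ {u} {v} → inv-cong u v
        }
      ; comm = λ u v → *-comm (proj₁ u) (proj₁ v)
      }
    }

  open AbelianPowers unitGroup

  unit-cancelˡ : ∀ u {a b} → proj₁ u * a ≈ proj₁ u * b → a ≈ b
  unit-cancelˡ u {a} {b} ua≈ub = begin
    a                       ≈⟨ cancel a ⟨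
    inv u * (proj₁ u * a)   ≈⟨ *-congˡ ua≈ub ⟩
    inv u * (proj₁ u * b)   ≈⟨ cancel b ⟩
    b                       ∎
    where
    cancel : ∀ a → inv u * (proj₁ u * a) ≈ a
    cancel a = trans (sym (*-assoc _ _ _)) (trans (*-congʳ (inv-inverseˡ u)) (*-identityˡ a))

  -- f is a polynomial function of degree at most m whose coefficient of
  -- degree m is l, described through iterated difference quotients.
  Polynomial : ℕ → Carrier → (Carrier → Carrier) → Set (c ⊔ ℓ₁)
  Polynomial zero    l f = Level.Lift c (∀ z → f z ≈ l)
  Polynomial (suc m) l f = ∀ r → ∃ λ g → Polynomial m l g × (∀ z → f z ≈ f r + (z - r) * g z)

  polynomial-+ : ∀ m {a b f g} → Polynomial m a f → Polynomial m b g → Polynomial m (a + b) (λ z → f z + g z)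
  polynomial-+ zero    (Level.lift f≈a) (Level.lift g≈b) = Level.lift λ z → +-cong (f≈a z) (g≈b z)
  polynomial-+ (suc m) {f = f} {g} F G r with F r | G r
  ... | f′ , F′ , f≈ | g′ , G′ , g≈ = (λ z → f′ z + g′ z) , polynomial-+ m F′ G′ , λ z →
    trans (+-cong (f≈ z) (g≈ z))
      (solve 5 (λ p q d x y → (p :+ d :* x) :+ (q :+ d :* y) := (p :+ q) :+ d :* (x :+ y)) refl
        (f r) (g r) (z - r) (f′ z) (g′ z))

  polynomial-* : ∀ m s {a f} → Polynomial m a f → Polynomial m (s * a) (λ z → s * f z)
  polynomial-* zero    s (Level.lift f≈a) = Level.lift λ z → *-congˡ (f≈a z)
  polynomial-* (suc m) s {f = f} F r with F r
  ... | f′ , F′ , f≈ = (λ z → s * f′ z) , polynomial-* m s F′ , λ z →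
    trans (*-congˡ (f≈ z))
      (solve 4 (λ s p d x → s :* (p :+ d :* x) := s :* p :+ d :* (s :* x)) refl s (f r) (z - r) (f′ z))

  polynomial-raise : ∀ m {a f} → Polynomial m a f → Polynomial (suc m) 0# f
  polynomial-raise zero    {a} {f} (Level.lift f≈a) r = (λ _ → 0#) , Level.lift (λ _ → refl) , λ z → begin
    f z                  ≈⟨ trans (f≈a z) (sym (f≈a r)) ⟩
    f r                  ≈⟨ +-identityʳ _ ⟨
    f r + 0#             ≈⟨ +-congˡ (zeroʳ _) ⟨
    f r + (z - r) * 0#   ∎
  polynomial-raise (suc m) F r with F r
  ... | f′ , F′ , f≈ = f′ , polynomial-raise m F′ , f≈

  polynomial-lead : ∀ m {a b f} → a ≈ b → Polynomial m a f → Polynomial m b f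
  polynomial-lead zero    a≈b (Level.lift f≈a) = Level.lift λ z → trans (f≈a z) a≈b
  polynomial-lead (suc m) a≈b F r with F r
  ... | f′ , F′ , f≈ = f′ , polynomial-lead m a≈b F′ , f≈

  difference-+ : ∀ z r → z ≈ r + (z - r)
  difference-+ z r = begin
    z               ≈⟨ +-identityʳ z ⟨
    z + 0#          ≈⟨ +-congˡ (-‿inverseˡ r) ⟨
    z + (- r + r)   ≈⟨ +-assoc z (- r) r ⟨
    z - r + r       ≈⟨ +-comm _ r ⟩
    r + (z - r)     ∎

  -- Product rule: the difference quotient of z f(z) at r is f(z) + r f′(z), with f′ the difference
  -- quotient of f. The second summand has smaller degree, so the leading coefficient is that of f.
  polynomial-shift : ∀ m {a f} → Polynomial m a f → Polynomial (suc m) a (λ z → z * f z)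
  polynomial-shift zero {a} {f} (Level.lift f≈a) r = f , Level.lift f≈a , λ z → begin
    z * f z                        ≈⟨ *-congʳ (difference-+ z r) ⟩
    (r + (z - r)) * f z            ≈⟨ distribʳ (f z) r (z - r) ⟩
    r * f z + (z - r) * f z        ≈⟨ +-congʳ (*-congˡ (trans (f≈a z) (sym (f≈a r)))) ⟩
    r * f r + (z - r) * f z        ∎
  polynomial-shift (suc m) {a} {f} F r with F r
  ... | f′ , F′ , f≈ = (λ z → f z + r * f′ z)
    , polynomial-lead (suc m) (+-identityʳ a) (polynomial-+ (suc m) F (polynomial-raise m (polynomial-* m r F′)))
    , λ z → begin
      z * f z                                     ≈⟨ *-congʳ (difference-+ z r) ⟩
      (r + (z - r)) * f z                         ≈⟨ distribʳ (f z) r (z - r) ⟩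
      r * f z + (z - r) * f z                     ≈⟨ +-congʳ (*-congˡ (f≈ z)) ⟩
      r * (f r + (z - r) * f′ z) + (z - r) * f z
        ≈⟨ solve 5 (λ r p d x y → r :* (p :+ d :* x) :+ d :* y := r :* p :+ d :* (y :+ r :* x)) refl
             r (f r) (z - r) (f′ z) (f z) ⟩
      r * f r + (z - r) * (f z + r * f′ z)        ∎

  power : ℕ → Carrier → Carrier
  power zero    z = 1#
  power (suc m) z = z * power m z

  polynomial-power : ∀ m → Polynomial m 1# (power m)
  polynomial-power zero    = Level.lift λ _ → refl
  polynomial-power (suc m) = polynomial-shift m (polynomial-power m)

  Injective : ∀ {k} → (Fin k → Carrier) → Set ℓ₁
  Injective p = ∀ i j → p i ≈ p j → i ≡ j

  -- The difference quotient at `p zero` vanishes wherever `f` takes the same value again. Allowing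
  -- any common value `v` covers both zeros and the equation z ^ m = 1.
  quotient-zeros : ∀ {m l f v} → Polynomial (suc m) l f → (p : Fin (suc (suc m)) → Carrier) → Injective p →
                   (∀ i → f (p i) ≈ v) → ∃ λ g → Polynomial m l g × (∀ i → g (p (suc i)) ≈ 0#)
  quotient-zeros {f = f} {v} F p p-injective f≈v with F (p zero)
  ... | g , G , f≈ = g , G , λ i → unit-cancelˡ (difference i) (begin
    (p (suc i) - p zero) * g (p (suc i))  ≈⟨ cancel (trans (sym (f≈ (p (suc i)))) (trans (f≈v (suc i)) (sym (f≈v zero)))) ⟩
    0#                                    ≈⟨ zeroʳ _ ⟨
    (p (suc i) - p zero) * 0#             ∎)
    where
    difference : Fin _ → Unit
    difference i = p (suc i) - p zero
      , ≉0⇒#0 _ λ eq → contradiction (p-injective (suc i) zero (x-y≈0⇒x≈y _ _ eq)) λ ()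
    cancel : ∀ {a b} → a + b ≈ a → b ≈ 0#
    cancel {a} {b} a+b≈a = begin
      b             ≈⟨ +-identityˡ b ⟨
      0# + b        ≈⟨ +-congʳ (-‿inverseˡ a) ⟨
      - a + a + b   ≈⟨ +-assoc (- a) a b ⟩
      - a + (a + b) ≈⟨ +-congˡ a+b≈a ⟩
      - a + a       ≈⟨ -‿inverseˡ a ⟩
      0#            ∎

  too-many-zeros : ∀ m {l f} → Polynomial m l f → (p : Fin (suc m) → Carrier) → Injective p →
                   (∀ i → f (p i) ≈ 0#) → l ≈ 0#
  too-many-zeros zero    (Level.lift f≈l) p p-injective zeros = trans (sym (f≈l (p zero))) (zeros zero)
  too-many-zeros (suc m) F p p-injective zeros with quotient-zeros F p p-injective zeros
  ... | g , G , zeros′ = too-many-zeros m G (p ∘ suc)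
    (λ i j eq → Fin.suc-injective (p-injective (suc i) (suc j) eq)) zeros′

  power-^ : ∀ m u → proj₁ (u ^ m) ≈ power m (proj₁ u)
  power-^ zero    u = refl
  power-^ (suc m) u = *-congˡ (power-^ m u)

  module _ {n} (enumeration : Inverse (≡.setoid (Fin n)) UnitSetoid) where
    private module E = Inverse enumeration

    -- If all units satisfied w ^ m = 1, then m + 1 of the n units would already force the leading
    -- coefficient 1 of z ^ m to vanish.
    non-trivial-power : ∀ m → 0 ℕ.< m → m ℕ.< n → ∃ λ w → ¬ proj₁ (w ^ m) ≈ 1#
    non-trivial-power (suc m) _ m<n with Fin.any? (λ i → ¬? (proj₁ (E.to i ^ suc m) ≈? 1#))
    ... | yes (i , ≉1) = E.to i , ≉1
    ... | no  none     = contradiction (too-many-zeros m G (p ∘ suc)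
        (λ i j eq → Fin.suc-injective (p-injective (suc i) (suc j) eq)) zeros) (#0⇒≉0 1# 1#0)
      where
      p : Fin (suc (suc m)) → Carrier
      p i = proj₁ (E.to (inject≤ i m<n))
      p-injective : Injective p
      p-injective i j eq = Fin.inject≤-injective m<n m<n i j
        (≡.trans (≡.sym (E.strictlyInverseʳ _)) (≡.trans (E.from-cong eq) (E.strictlyInverseʳ _)))
      quotient = quotient-zeros {m} (polynomial-power (suc m)) p p-injective λ i →
        trans (sym (power-^ (suc m) (E.to (inject≤ i m<n))))
          (decidable-stable (_ ≈? _) λ ≉1 → none (inject≤ i m<n , ≉1))
      G = proj₁ (proj₂ quotient)
      zeros = proj₂ (proj₂ quotient)

    primitive-root : ∃ λ x → HasOrder x n
    primitive-root = cyclic enumeration non-trivial-power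

-- The group ring element and its determinant.

module Construction {c ℓ₁ ℓ₂} (F : FiniteField c ℓ₁ ℓ₂) where

  open import Defs
  open import Algebra.Bundles using (AbelianGroup)
  open Determinants
  open BlockDeterminants
  open Indicators
  open CyclicGroups
  open FieldUnits F
  open import Data.Fin.Base as Fin using (Fin; zero; suc; toℕ; inject₁)
  import Data.Fin.Properties as Fin
  open import Data.Integer.Base as ℤ using (ℤ; 0ℤ; 1ℤ; _+_; _*_; _-_; _^_)
  open import Data.Integer.Divisibility.Signed using (_∣_; ∣ᵤ⇒∣; ∣⇒∣ᵤ; ∣m∣n⇒∣m+n; ∣n⇒∣m*n)
  open import Data.Integer.DivMod using (a≡a%ℕn+[a/ℕn]*n)
  import Data.Integer.Properties as ℤ
  open import Data.Integer.Tactic.RingSolver using (solve-∀)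
  open import Data.Nat.Base as ℕ using (ℕ; zero; suc)
  open import Data.Nat.Coprimality using (Coprime)
  import Data.Nat.Properties as ℕ
  open import Data.Product.Base using (∃; _,_; proj₁; proj₂)
  open import Data.Product.Relation.Binary.Pointwise.NonDependent using (_×ₛ_)
  open import Function.Base using (_∘_)
  open import Function.Bundles using (Func; Inverse; _⟨$⟩_)
  import Function.Construct.Composition as Compose
  open import Level using (_⊔_)
  open import Relation.Binary.Bundles using (Setoid)
  open import Relation.Binary.PropositionalEquality as ≡ using (_≡_; _≢_; refl; cong; cong₂; subst)
  import Relation.Binary.Reasoning.Setoid as ≈-Reasoning
  open import Relation.Nullary using (¬_; yes; no; contradiction)
  open ∑ using (sum)

  *-^ : ∀ x y k → (x * y) ^ k ≡ x ^ k * y ^ k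
  *-^ x y zero    = refl
  *-^ x y (suc k) = ≡.trans (cong (x * y *_) (*-^ x y k)) (arith x y (x ^ k) (y ^ k))
    where
    arith : ∀ x y z w → x * y * (z * w) ≡ x * z * (y * w)
    arith = solve-∀

  -- Here `N` is n and `1ℤ + N` is q. The base of the power is n B, and n B - n m q = n A, so each
  -- of the `suc k` factors releases one `N`.
  cancel-scale : ∀ N k {a t A m D} → N ≢ 0ℤ → A ≡ a + t * N →
    N ^ suc k * D ≡ (N * (a + N * (t + m) + m) - N * m * (1ℤ + N)) * (N * (a + N * (t + m) + m)) ^ k →
    D ≡ A * (A + (1ℤ + N) * m) ^ k
  cancel-scale N k {a} {t} {A} {m} {D} N≢0 refl eq = ℤ.*-cancelˡ-≡ (N ^ suc k) D (A * B ^ k) (begin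
    N ^ suc k * D
      ≡⟨ eq ⟩
    (N * (a + N * (t + m) + m) - N * m * (1ℤ + N)) * (N * (a + N * (t + m) + m)) ^ k
      ≡⟨ cong (λ z → (N * z - N * m * (1ℤ + N)) * (N * z) ^ k) (arith₁ a N t m) ⟩
    (N * B - N * m * (1ℤ + N)) * (N * B) ^ k
      ≡⟨ cong₂ _*_ (arith₂ N A m) (*-^ N B k) ⟩
    N * A * (N ^ k * B ^ k)
      ≡⟨ arith₃ N A (N ^ k) (B ^ k) ⟩
    N ^ suc k * (A * B ^ k) ∎)
    where
    open ≡.≡-Reasoning
    B = A + (1ℤ + N) * m
    instance
      _ : ℤ.NonZero (N ^ suc k)
      _ = ℤ.≢-nonZero λ eq → N≢0 (ℤ.i^n≡0⇒i≡0 N (suc k) eq)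
    arith₁ : ∀ a n t m → a + n * (t + m) + m ≡ (a + t * n) + (1ℤ + n) * m
    arith₁ = solve-∀
    arith₂ : ∀ n a m → n * (a + (1ℤ + n) * m) - n * m * (1ℤ + n) ≡ n * a
    arith₂ = solve-∀
    arith₃ : ∀ n a x y → n * a * (x * y) ≡ n * x * (a * y)
    arith₃ = solve-∀

  private module 𝔽 = FiniteField F
  open 𝔽 using (Carrier; _≈_; 0#; 1#; setoid; sym; trans; *-cong; *-congˡ; *-congʳ; *-assoc; *-identityˡ; *-identityʳ)
  open GeneralAffine F
  open AbelianPowers unitGroup renaming (_^_ to _^ᵁ_)

  PairSetoid : Setoid (c ⊔ ℓ₂) ℓ₁
  PairSetoid = UnitSetoid ×ₛ setoid

  *-inv-cancel : ∀ h b → proj₁ h 𝔽.* (inv h 𝔽.* b) ≈ b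
  *-inv-cancel h b = trans (sym (*-assoc _ _ _)) (trans (*-congʳ (inv-inverseʳ h)) (*-identityˡ b))

  inv-*-cancel : ∀ h b → inv h 𝔽.* (proj₁ h 𝔽.* b) ≈ b
  inv-*-cancel h b = trans (sym (*-assoc _ _ _)) (trans (*-congʳ (inv-inverseˡ h)) (*-identityˡ b))

  -- With respect to the coordinates (h , u) the subgroup of all (h , 0) acts
  -- on the first coordinate only.
  shear : Inverse PairSetoid (FiniteGroup.setoid finiteGroup)
  shear = record
    { to        = λ (h , u) → h , proj₁ h 𝔽.* u
    ; from      = λ (h , b) → h , inv h 𝔽.* b
    ; to-cong   = λ (p , q) → p , *-cong p q
    ; from-cong = λ {(g , _)} {(h , _)} (p , q) → p , *-cong (inv-cong g h p) q
    ; inverse   =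
        (λ {(h , b)} (p , q) → p , trans (*-cong p q) (*-inv-cancel h b))
      , (λ {(h , u)} {(g , b)} (p , q) → p , trans (*-cong (inv-cong g h p) q) (inv-*-cancel h u))
    }
  private module Shear = Inverse shear

  I : Carrier → Carrier → ℤ
  I x y = ⟦ x ≈? y ⟧

  I-cong : ∀ {x x′ y y′} → x ≈ x′ → y ≈ y′ → I x y ≡ I x′ y′
  I-cong x≈x′ y≈y′ = ⟦⟧-⇔ (_ ≈? _) (_ ≈? _)
    (λ x≈y → trans (sym x≈x′) (trans x≈y y≈y′)) (λ x′≈y′ → trans x≈x′ (trans x′≈y′ (sym y≈y′)))

  I-cancel : ∀ h x y → I (proj₁ h 𝔽.* x) (proj₁ h 𝔽.* y) ≡ I x y
  I-cancel h x y = ⟦⟧-⇔ (_ ≈? _) (_ ≈? _) (unit-cancelˡ h) *-congˡ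

  difference≈0 : ∀ {u v} → u 𝔽.- v ≈ 0# → u ≈ v
  difference≈0 {u} {v} u-v≈0 = trans (difference-+ u v) (trans (𝔽.+-congˡ u-v≈0) (𝔽.+-identityʳ v))

  I-difference : ∀ u v → I (u 𝔽.- v) 0# ≡ I u v
  I-difference u v = ⟦⟧-⇔ (_ ≈? _) (_ ≈? _) difference≈0
    (λ u≈v → trans (𝔽.+-congʳ u≈v) (𝔽.-‿inverseʳ v))

  module _ {n} (units : Inverse (≡.setoid (Fin n)) UnitSetoid) where
    private module E = Inverse units

    I-units : ∀ i j → I (proj₁ (E.to i)) (proj₁ (E.to j)) ≡ δ i j
    I-units i j = ⟦⟧-δ (_ ≈? _) i j
      (λ eq → ≡.trans (≡.sym (E.strictlyInverseʳ i)) (≡.trans (E.from-cong eq) (E.strictlyInverseʳ j)))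
      (λ { refl → 𝔽.refl })

    -- Inverses of units run through the nonzero elements once each, so u - v is hit exactly once
    -- unless it is zero.
    ∑-I-inv : ∀ u v → sum (λ j → I (u 𝔽.- v) (inv (E.to j))) ≡ 1ℤ - I u v
    ∑-I-inv u v with u ≈? v
    ... | yes u≈v = sum-zero λ j → ⟦⟧-no (_ ≈? _) λ eq →
      #0⇒≉0 _ (proj₂ (inv-unit (E.to j))) (trans (sym eq) (trans (𝔽.+-congʳ u≈v) (𝔽.-‿inverseʳ v)))
    ... | no  u≉v = ∑-⟦⟧-unique units (λ j → _ ≈? inv (E.to j)) (inv-unit w)
      (λ j eq → unit-cancelˡ w (trans (*-congʳ eq) (trans (inv-inverseˡ (E.to j)) (sym (inv-inverseʳ w)))))
      (λ j eq → unit-cancelˡ (E.to j) (trans (*-congʳ eq) (trans (inv-inverseˡ w) (sym (inv-inverseʳ (E.to j))))))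
      where
      w : Unit
      w = u 𝔽.- v , ≉0⇒#0 _ (u≉v ∘ difference≈0)

  module _ (x : Unit) (a : ℕ) (t m : ℤ) where

    -- The coefficient of h in 1 + x + ⋯ + xᵃ⁻¹.
    geometric : Carrier → ℤ
    geometric h = sum {a} λ k → I (proj₁ (x ^ᵁ toℕ k)) h

    geometric-cong : ∀ {g h} → g ≈ h → geometric g ≡ geometric h
    geometric-cong g≈h = ∑.sum-cong-≗ {a} λ k → I-cong 𝔽.refl g≈h

    -- Multiplying both sides of xᵏ = g by x raises every exponent by one, so all terms cancel
    -- except those of x⁰ and xᵃ.
    geometric-step : ∀ g → geometric (proj₁ x 𝔽.* g) - geometric g ≡
                     I 1# (proj₁ x 𝔽.* g) - I (proj₁ (x ^ᵁ a)) (proj₁ x 𝔽.* g)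
    geometric-step g = begin
      geometric y - geometric g
        ≡⟨ cong (geometric y -_) (∑.sum-cong-≗ {a} λ k → ≡.sym (I-cancel x (proj₁ (x ^ᵁ toℕ k)) g)) ⟩
      geometric y - sum {a} (λ k → f (suc (toℕ k)))
        ≡⟨ ∑-difference {a} (λ k → f (toℕ k)) (λ k → f (suc (toℕ k))) ⟨
      sum {a} (λ k → f (toℕ k) - f (suc (toℕ k)))
        ≡⟨ telescope a f ⟩
      f 0 - f a ∎
      where
      open ≡.≡-Reasoning
      y = proj₁ x 𝔽.* g
      f : ℕ → ℤ
      f k = I (proj₁ (x ^ᵁ k)) y

    -- Each of the `a` powers is met exactly once, namely at the unit xˡ h.
    ∑-geometric : ∀ {n} (units : Inverse (≡.setoid (Fin n)) UnitSetoid) h →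
                  sum (λ k → geometric (proj₁ (Inverse.to units k) 𝔽.* inv h)) ≡ ℤ.+ a
    ∑-geometric {n} units h = begin
      sum (λ k → geometric (proj₁ (E.to k) 𝔽.* inv h))
        ≡⟨ ∑.∑-comm {n} {a} (λ k l → I (proj₁ (x ^ᵁ toℕ l)) (proj₁ (E.to k) 𝔽.* inv h)) ⟩
      sum {a} (λ l → sum (λ k → I (proj₁ (x ^ᵁ toℕ l)) (proj₁ (E.to k) 𝔽.* inv h)))
        ≡⟨ ∑.sum-cong-≗ {a} (λ l → ∑-⟦⟧-unique units (λ k → proj₁ (x ^ᵁ toℕ l) ≈? (proj₁ (E.to k) 𝔽.* inv h))
             (AbelianGroup._∙_ unitGroup (x ^ᵁ toℕ l) h)
             (λ k eq → sym (trans (*-congʳ eq) (trans (*-assoc _ _ _)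
               (trans (*-congˡ (inv-inverseˡ h)) (*-identityʳ _)))))
             (λ k eq → sym (trans (*-congʳ eq) (trans (*-assoc _ _ _)
               (trans (*-congˡ (inv-inverseʳ h)) (*-identityʳ _)))))) ⟩
      sum {a} (λ l → 1ℤ)
        ≡⟨ ∑-const a 1ℤ ⟩
      ℤ.+ a * 1ℤ
        ≡⟨ ℤ.*-identityʳ _ ⟩
      ℤ.+ a ∎
      where
      open ≡.≡-Reasoning
      module E = Inverse units

    -- 1 + x + ⋯ + xᵃ⁻¹ + N (t - m τ), where N is the sum of all (h , 0) and
    -- τ = (1 , 1).
    α : GroupRing finiteGroup
    α = record
      { to   = λ ((h , _) , b) → (geometric h + t) * I b 0# - m * I b h
      ; cong = λ (p , q) → cong₂ (λ z w → z - m * w)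
          (cong₂ (λ z w → (z + t) * w) (geometric-cong p) (I-cong q 𝔽.refl)) (I-cong q p)
      }

    -- The translation part of the product is h′ (u′ - u) and its linear part is h′ / h; cancelling
    -- h′ gives the two conditions u′ = u and u′ - u = 1 / h.
    entry : ∀ h′ u′ h u →
      α ⟨$⟩ (Shear.to (h′ , u′) · FiniteGroup._⁻¹ finiteGroup (Shear.to (h , u))) ≡
      (geometric (proj₁ h′ 𝔽.* inv h) + t) * I u′ u - m * I (u′ 𝔽.- u) (inv h)
    entry h′ u′ h u = cong₂ (λ z w → (geometric (proj₁ h′ 𝔽.* inv h) + t) * z - m * w)
      (≡.trans (I-cong b≈ (sym (𝔽.zeroʳ _))) (≡.trans (I-cancel h′ _ _) (I-difference u′ u)))
      (≡.trans (I-cong b≈ 𝔽.refl) (I-cancel h′ _ _))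
      where
      open ≈-Reasoning setoid
      b≈ : proj₁ h′ 𝔽.* 𝔽.- (inv h 𝔽.* (proj₁ h 𝔽.* u)) 𝔽.+ proj₁ h′ 𝔽.* u′ ≈ proj₁ h′ 𝔽.* (u′ 𝔽.- u)
      b≈ = begin
        proj₁ h′ 𝔽.* 𝔽.- (inv h 𝔽.* (proj₁ h 𝔽.* u)) 𝔽.+ proj₁ h′ 𝔽.* u′
          ≈⟨ 𝔽.+-congʳ (*-congˡ (𝔽.-‿cong (inv-*-cancel h u))) ⟩
        proj₁ h′ 𝔽.* 𝔽.- u 𝔽.+ proj₁ h′ 𝔽.* u′ ≈⟨ 𝔽.+-comm _ _ ⟩
        proj₁ h′ 𝔽.* u′ 𝔽.+ proj₁ h′ 𝔽.* 𝔽.- u ≈⟨ 𝔽.distribˡ _ _ _ ⟨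
        proj₁ h′ 𝔽.* (u′ 𝔽.- u)                ∎

    module _ {n q} (units : Inverse (≡.setoid (Fin (suc n))) UnitSetoid)
      (elements : Inverse (≡.setoid (Fin (suc q))) setoid) (X : HasOrder x (suc n)) (a⊥n : Coprime a (suc n)) where

      private
        module E = Inverse elements
        N : ℤ
        N = ℤ.+ suc n
        y : Unit
        y = x ^ᵁ a
        x-powers y-powers : Inverse (≡.setoid (Fin (suc n))) UnitSetoid
        x-powers = powers-enumerate units X
        y-powers = powers-enumerate units (coprime-^-order a⊥n X)
        module X = Inverse x-powers
        module Y = Inverse y-powers

        I-elements : ∀ u v → I (E.to u) (E.to v) ≡ δ u v
        I-elements u v = ⟦⟧-δ (_ ≈? _) u v
          (λ eq → ≡.trans (≡.sym (E.strictlyInverseʳ u)) (≡.trans (E.from-cong eq) (E.strictlyInverseʳ v)))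
          (λ { refl → 𝔽.refl })

        M : Array (suc n) (suc q)
        M i u j v = α ⟨$⟩ (Shear.to (X.to i , E.to u) · FiniteGroup._⁻¹ finiteGroup (Shear.to (X.to j , E.to v)))

        row₁ row₂ : Setoid.Carrier PairSetoid → Setoid.Carrier PairSetoid → ℤ
        row₁ (_ , u) (h , v) = (ℤ.+ a + N * t) * I u v - N * m * I (u 𝔽.- v) (inv h)
        row₂ (g , u) (h , v) = (I (proj₁ g) (proj₁ h) - I (proj₁ g) (proj₁ y 𝔽.* proj₁ h)) * I u v

        -- The product of `Z` and `M` as a function of field elements instead of indices, which lets
        -- `det-reindex` replace the powers of x by those of `y`. The special row is recognised by g
        -- = 1, the zeroth power in both enumerations; weighting by an indicator keeps the function
        -- visibly compatible with `_≈_`.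
        ZM : Setoid.Carrier PairSetoid → Setoid.Carrier PairSetoid → ℤ
        ZM g h = I (proj₁ (proj₁ g)) 1# * row₁ g h + (1ℤ - I (proj₁ (proj₁ g)) 1#) * row₂ g h

        ZM-cong : ∀ {g g′ h h′} → Setoid._≈_ PairSetoid g g′ → Setoid._≈_ PairSetoid h h′ → ZM g h ≡ ZM g′ h′
        ZM-cong {h = h , _} {h′ , _} (p , q) (r , s) = cong₂ _+_
          (cong₂ _*_ (I-cong p 𝔽.refl)
            (cong₂ (λ z w → (ℤ.+ a + N * t) * z - N * m * w) (I-cong q s)
              (I-cong (𝔽.+-cong q (𝔽.-‿cong s)) (inv-cong h h′ r))))
          (cong₂ _*_ (cong (1ℤ -_) (I-cong p 𝔽.refl))
            (cong₂ _*_ (cong₂ _-_ (I-cong p r) (I-cong p (*-congˡ r))) (I-cong q s)))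

        identity-row : ∀ {g} u {h} → proj₁ g ≈ 1# → ZM (g , u) h ≡ row₁ (g , u) h
        identity-row {g} u {h} g≈1 = ≡.trans
          (cong (λ z → z * row₁ (g , u) h + (1ℤ - z) * row₂ (g , u) h) (⟦⟧-yes (_ ≈? _) g≈1))
          (arith (row₁ (g , u) h) (row₂ (g , u) h))
          where
          arith : ∀ z w → 1ℤ * z + (1ℤ - 1ℤ) * w ≡ z
          arith = solve-∀

        other-row : ∀ {g} u {h} → ¬ proj₁ g ≈ 1# → ZM (g , u) h ≡ row₂ (g , u) h
        other-row {g} u {h} g≉1 = ≡.trans
          (cong (λ z → z * row₁ (g , u) h + (1ℤ - z) * row₂ (g , u) h) (⟦⟧-no (_ ≈? _) g≉1))
          (arith (row₁ (g , u) h) (row₂ (g , u) h))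
          where
          arith : ∀ z w → 0ℤ * z + (1ℤ - 0ℤ) * w ≡ w
          arith = solve-∀

        ZM-entry : ∀ i u j v → (Z ⊙₂ M) i u j v ≡ ZM (X.to i , E.to u) (X.to j , E.to v)
        ZM-entry zero u j v = begin
          (Z ⊙₂ M) zero u j v
            ≡⟨ Z-⊙₂ M zero u j v ⟩
          sum (λ k → 1ℤ * M k u j v)
            ≡⟨ ∑.sum-cong-≗ (λ k → ≡.trans (cong (1ℤ *_) (entry (X.to k) (E.to u) (X.to j) (E.to v)))
                 (arith (s k) t d (m * J))) ⟩
          sum (λ k → s k * d + (t * d - m * J))
            ≡⟨ ∑.∑-distrib-+ (λ k → s k * d) (λ _ → t * d - m * J) ⟩
          sum (λ k → s k * d) + sum {suc n} (λ _ → t * d - m * J)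
            ≡⟨ cong₂ _+_
                 (≡.trans (≡.sym (∑.*-distribʳ-sum d s)) (cong (_* d) (∑-geometric x-powers (X.to j))))
                 (∑-const (suc n) (t * d - m * J)) ⟩
          ℤ.+ a * d + N * (t * d - m * J)
            ≡⟨ arith′ (ℤ.+ a) N t m d J ⟩
          row₁ (X.to zero , E.to u) (X.to j , E.to v)
            ≡⟨ identity-row {X.to zero} (E.to u) 𝔽.refl ⟨
          ZM (X.to zero , E.to u) (X.to j , E.to v) ∎
          where
          open ≡.≡-Reasoning
          s : Fin (suc n) → ℤ
          s k = geometric (proj₁ (X.to k) 𝔽.* inv (X.to j))
          d J : ℤ
          d = I (E.to u) (E.to v)
          J = I (E.to u 𝔽.- E.to v) (inv (X.to j))
          arith : ∀ s t d w → 1ℤ * ((s + t) * d - w) ≡ s * d + (t * d - w)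
          arith = solve-∀
          arith′ : ∀ a n t m d j → a * d + n * (t * d - m * j) ≡ (a + n * t) * d - n * m * j
          arith′ = solve-∀
        ZM-entry (suc i) u j v = begin
          (Z ⊙₂ M) (suc i) u j v
            ≡⟨ Z-⊙₂ M (suc i) u j v ⟩
          sum (λ k → (δ (suc i) k - δ (inject₁ i) k) * M k u j v)
            ≡⟨ ∑-δ-difference (suc i) (inject₁ i) (λ k → M k u j v) ⟩
          M (suc i) u j v - M (inject₁ i) u j v
            ≡⟨ cong₂ _-_ (entry (X.to (suc i)) (E.to u) h (E.to v)) (entry (X.to (inject₁ i)) (E.to u) h (E.to v)) ⟩
          ((s (suc i) + t) * d - w) - ((s (inject₁ i) + t) * d - w)
            ≡⟨ arith (s (suc i)) (s (inject₁ i)) t d w ⟩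
          (s (suc i) - s (inject₁ i)) * d
            ≡⟨ cong (_* d) (cong₂ _-_ (geometric-cong (*-assoc _ _ _))
                 (geometric-cong (𝔽.reflexive (cong (λ k → proj₁ (x ^ᵁ k) 𝔽.* inv h) (Fin.toℕ-inject₁ i))))) ⟩
          (geometric (proj₁ x 𝔽.* g) - geometric g) * d
            ≡⟨ cong (_* d) (geometric-step g) ⟩
          (I 1# (proj₁ x 𝔽.* g) - I (proj₁ y) (proj₁ x 𝔽.* g)) * d
            ≡⟨ cong (_* d) (cong₂ _-_ (quotient 1# (*-identityˡ _)) (quotient (proj₁ y) 𝔽.refl)) ⟩
          row₂ (X.to (suc i) , E.to u) (h , E.to v)
            ≡⟨ other-row {X.to (suc i)} (E.to u) (λ eq → contradiction (powers-injective X (suc i) zero eq) λ ()) ⟨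
          ZM (X.to (suc i) , E.to u) (h , E.to v) ∎
          where
          open ≡.≡-Reasoning
          h = X.to j
          g = proj₁ (x ^ᵁ toℕ i) 𝔽.* inv h
          s : Fin (suc n) → ℤ
          s k = geometric (proj₁ (X.to k) 𝔽.* inv h)
          d w : ℤ
          d = I (E.to u) (E.to v)
          w = m * I (E.to u 𝔽.- E.to v) (inv h)
          arith : ∀ s s′ t d w → ((s + t) * d - w) - ((s′ + t) * d - w) ≡ (s - s′) * d
          arith = solve-∀
          -- Since x g is the power with exponent i + 1 divided by h, multiplying by h clears the
          -- division.
          quotient : ∀ z {z′} → z 𝔽.* proj₁ h ≈ z′ → I z (proj₁ x 𝔽.* g) ≡ I (proj₁ (X.to (suc i))) z′
          quotient z zh≈z′ = ⟦⟧-⇔ (_ ≈? _) (_ ≈? _)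
            (λ eq → trans (sym x^h) (trans (*-congʳ (sym eq)) zh≈z′))
            (λ eq → trans (sym (*-identityʳ z)) (trans (*-congˡ (sym (inv-inverseʳ h)))
              (trans (sym (*-assoc _ _ _)) (trans (*-congʳ (trans zh≈z′ (sym eq))) (*-assoc _ _ _)))))
            where
            x^h : (proj₁ x 𝔽.* g) 𝔽.* proj₁ h ≈ proj₁ (X.to (suc i))
            x^h = trans (*-congʳ (sym (*-assoc _ _ _))) (trans (*-assoc _ _ _)
              (trans (*-congˡ (inv-inverseˡ h)) (*-identityʳ _)))

        Y : Array (suc n) (suc q)
        Y i u j v = ZM (Y.to i , E.to u) (Y.to j , E.to v)

        reindex : det₂ (Z ⊙₂ M) ≡ det₂ Y
        reindex = ≡.trans (det₂-cong {A = Z ⊙₂ M} {λ i u j v → ZM (X.to i , E.to u) (X.to j , E.to v)} ZM-entry)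
          (det-reindex (enumerate-× x-powers elements) (enumerate-× y-powers elements) ZM
            (λ {g} {g′} {h} {h′} → ZM-cong {g} {g′} {h} {h′}))

        -- By `∑-I-inv` the last term sums to -n m (1 - δ), whose δ part supplies the extra `m` in
        -- the coefficient of `δ u v`.
        Y-top : ∀ u v → sum (λ j → Y zero u j v) ≡ N * (ℤ.+ a + N * t + m) * δ u v - N * m
        Y-top u v = begin
          sum (λ j → Y zero u j v)
            ≡⟨ ∑.sum-cong-≗ (λ j → identity-row {Y.to zero} (E.to u) {Y.to j , E.to v} 𝔽.refl) ⟩
          sum (λ j → k - N * m * J j)
            ≡⟨ ∑-difference (λ _ → k) (λ j → N * m * J j) ⟩
          sum {suc n} (λ _ → k) - sum (λ j → N * m * J j)
            ≡⟨ cong₂ _-_ (∑-const (suc n) k)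
                 (≡.trans (≡.sym (∑.*-distribˡ-sum (N * m) J)) (cong (N * m *_) (∑-I-inv y-powers (E.to u) (E.to v)))) ⟩
          N * k - N * m * (1ℤ - I (E.to u) (E.to v))
            ≡⟨ arith N (ℤ.+ a + N * t) m (I (E.to u) (E.to v)) ⟩
          N * (ℤ.+ a + N * t + m) * I (E.to u) (E.to v) - N * m
            ≡⟨ cong (λ z → N * (ℤ.+ a + N * t + m) * z - N * m) (I-elements u v) ⟩
          N * (ℤ.+ a + N * t + m) * δ u v - N * m ∎
          where
          open ≡.≡-Reasoning
          k : ℤ
          k = (ℤ.+ a + N * t) * I (E.to u) (E.to v)
          J : Fin (suc n) → ℤ
          J j = I (E.to u 𝔽.- E.to v) (inv (Y.to j))
          arith : ∀ n z m d → n * (z * d) - n * m * (1ℤ - d) ≡ n * (z + m) * d - n * m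
          arith = solve-∀

        -- For g the power of `y` with exponent i + 1, the condition g = y h says that h is the
        -- power with exponent i, the preceding index.
        Y-low : ∀ i u j v → Y (suc i) u j v ≡ differences (suc i) j * δ u v
        Y-low i u j v = ≡.trans
          (other-row {Y.to (suc i)} (E.to u) λ eq →
            contradiction (powers-injective (coprime-^-order a⊥n X) (suc i) zero eq) λ ())
          (cong₂ _*_
            (cong₂ _-_ (I-units y-powers (suc i) j)
              (≡.trans (I-cancel y _ _) (≡.trans
                (I-cong (𝔽.reflexive (cong (λ k → proj₁ (y ^ᵁ k)) (≡.sym (Fin.toℕ-inject₁ i)))) 𝔽.refl)
                (I-units y-powers (inject₁ i) j))))
            (I-elements u v))

      det-α : ∀ {r} (e : Inverse (≡.setoid (Fin r)) (FiniteGroup.setoid finiteGroup)) → r ≡ suc n ℕ.* suc q →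
              N ^ suc q * det (λ i j → α ⟨$⟩ (Inverse.to e i · FiniteGroup._⁻¹ finiteGroup (Inverse.to e j))) ≡
              (N * (ℤ.+ a + N * t + m) - N * m * ℤ.+ suc q) * (N * (ℤ.+ a + N * t + m)) ^ q
      det-α e refl = ≡.trans
        -- The given enumeration is exchanged for powers of x in the sheared coordinates, where the
        -- matrix is `flatten M`.
        (cong (N ^ suc q *_) (det-reindex e (Compose.inverse (enumerate-× x-powers elements) shear) f
          (λ {g} {g′} {h} {h′} → f-cong g g′ h h′)))
        (det-from-differences M Y (N * (ℤ.+ a + N * t + m)) (N * m) reindex Y-top Y-low)
        where
        module G = FiniteGroup finiteGroup
        f : Affine → Affine → ℤ
        f g h = α ⟨$⟩ (g · h G.⁻¹)
        f-cong : ∀ g g′ h h′ → g G.≈ g′ → h G.≈ h′ → f g h ≡ f g′ h′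
        f-cong g g′ h h′ p r = Func.cong α {g · h G.⁻¹} {g′ · h′ G.⁻¹}
          (G.∙-cong {g} {g′} {h G.⁻¹} {h′ G.⁻¹} p (G.⁻¹-cong {h} {h′} r))

  coprime-remainder : ∀ (A : ℤ) N .{{_ : ℕ.NonZero N}} → Coprime ℤ.∣ A ∣ N → Coprime (A ℤ.%ℕ N) N
  coprime-remainder A N A⊥N {d} (d∣a , d∣N) = A⊥N (∣⇒∣ᵤ d∣A , d∣N)
    where
    d∣A : ℤ.+ d ∣ A
    d∣A = subst (ℤ.+ d ∣_) (≡.sym (a≡a%ℕn+[a/ℕn]*n A N))
      (∣m∣n⇒∣m+n (∣ᵤ⇒∣ {ℤ.+ d} {ℤ.+ (A ℤ.%ℕ N)} d∣a) (∣n⇒∣m*n (A ℤ./ℕ N) (∣ᵤ⇒∣ {ℤ.+ d} {ℤ.+ N} d∣N)))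

  -- The sizes are variables tied by equations so that they can be matched as `suc n` and `suc q`,
  -- which the projection `order` does not permit.
  affine-determinant : ∀ {N Q r} (units : Inverse (≡.setoid (Fin N)) UnitSetoid)
    (elements : Inverse (≡.setoid (Fin Q)) setoid)
    (e : Inverse (≡.setoid (Fin r)) (FiniteGroup.setoid finiteGroup)) →
    N ≡ ℕ.pred Q → r ≡ N ℕ.* Q → (A m : ℤ) → Coprime ℤ.∣ A ∣ N →
    ∃ λ (α : GroupRing finiteGroup) →
      det (λ i j → α ⟨$⟩ (Inverse.to e i · FiniteGroup._⁻¹ finiteGroup (Inverse.to e j))) ≡
      A * (A + ℤ.+ Q * m) ^ N
  affine-determinant {zero} units _ _ _ _ _ _ _ with () ← Inverse.from units (AbelianGroup.ε unitGroup)
  affine-determinant {suc n} {suc q} units elements e refl r≡ A m A⊥N =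
    -- The subgroup sum N has coefficient t + m, so the parameter called t in `α` is t + m here.
    α x a (t + m) m ,
    cancel-scale (ℤ.+ suc n) (suc n) {ℤ.+ a} {t} {A} {m} (λ ()) (a≡a%ℕn+[a/ℕn]*n A (suc n))
      (det-α x a (t + m) m units elements X (coprime-remainder A (suc n) A⊥N) e r≡)
    where
    x = proj₁ (primitive-root units)
    X = proj₂ (primitive-root units)
    a = A ℤ.%ℕ suc n
    t = A ℤ./ℕ suc n

-- From the conditions on A and B to the parameters of the construction.

open import Data.Fin.Base using (Fin)
open import Data.Integer.Base using (ℤ; +_; 1ℤ; ∣_∣; _+_; _*_; _-_; _^_)
open import Data.Integer.Divisibility using (_∣_)
import Data.Integer.Divisibility.Signed as Signed
open import Data.Integer.GCD using (gcd)
import Data.Integer.Properties as ℤ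
open import Data.Integer.Tactic.RingSolver using (solve-∀)
open import Data.Nat.Base as ℕ using (ℕ; _≥_; _∸_)
open import Data.Nat.Coprimality using (Coprime; gcd≡1⇒coprime)
open import Data.Nat.Primality using (Prime)
open import Function.Bundles using (Inverse)
open import Level using (Level)
open import Relation.Binary.PropositionalEquality using (_≡_; refl; sym; trans; cong; subst)

-- The element of `Fin q` excludes q = 0, where q - 1 is -1 but `pred` gives 0; for a successor both
-- agree by computation.
gcd≡1⇒coprime-pred : ∀ A {q} → Fin q → gcd A (+ q - 1ℤ) ≡ 1ℤ → Coprime ∣ A ∣ (ℕ.pred q)
gcd≡1⇒coprime-pred A {ℕ.suc q} _ gcd≡1 = gcd≡1⇒coprime (ℤ.+-injective gcd≡1)

theorem2 : {c ℓ₁ ℓ₂ : Level} (p k q : ℕ) → Prime p → k ≥ 1 → q ≡ p ℕ.^ k →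
    (𝔽q : FiniteField c ℓ₁ ℓ₂) → FiniteField.order 𝔽q ≡ q →
    (A B : ℤ) → gcd A (+ q - 1ℤ) ≡ 1ℤ → + q ∣ B - A →
    IsIntegerGroupDeterminant (GA₁ 𝔽q) (A * B ^ (q ∸ 1))
theorem2 p k q _ _ _ 𝔽q refl A B gcd≡1 q∣B-A =
  subst (λ z → IsIntegerGroupDeterminant (GA₁ 𝔽q) (A * z ^ (q ∸ 1))) A+qm≡B
    (Construction.affine-determinant 𝔽q unitEnumeration enumeration
      (Defs.FiniteGroup.enumeration finiteGroup) refl refl A m
      (gcd≡1⇒coprime-pred A (Inverse.from enumeration 0#) gcd≡1))
  where
  open FiniteField 𝔽q using (enumeration; 0#)
  open Defs.GeneralAffine 𝔽q using (finiteGroup; unitEnumeration)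
  open Signed._∣_ (Signed.∣ᵤ⇒∣ {+ q} {B - A} q∣B-A) renaming (quotient to m; equality to B-A≡mq)
  A+qm≡B : A + + q * m ≡ B
  A+qm≡B = trans (cong (λ z → A + z) (trans (ℤ.*-comm (+ q) m) (sym B-A≡mq))) (arith A B)
    where
    arith : ∀ a b → a + (b - a) ≡ b
    arith = solve-∀
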